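{- Let $L|K$ be a finite cyclic field extension (i.e. a finite Galois extension with cyclic Galois group) of degree $n$. Then $L$ has a unitary grading over $K$ (which is necessarily a co-Galois grading) if and only if $|\mu_n(L)|=n$ and $|\mu_{\operatorname{er}(n)}(K)|=\operatorname{er}(n)$.
   Context: $\mu_m(F)=\{x\in F^\times:x^m=1\}$ for a field $F$. For $n\ge1$ let $\operatorname{r}(n)$ be the product of the distinct prime factors of $n$; the extended reduction is $\operatorname{er}(n)=\operatorname{r}(n)$ if $4\nmid n$ and $\operatorname{er}(n)=2\operatorname{r}(n)$ if $4\mid n$. Let $D$ be an abelian group (written additively). A unitary $D$-grading of $L$ over $K$ is a grading $L=\bigoplus_{d\in D}L_d$ ($K$-subspaces with $L_dL_e\subseteq L_{d+e}$) with $L_0=K$ and such that each $L_d$ contains a unit of $L$; a unitary grading is a unitary $D$-grading for some $D$. For a subgroup $D'\subseteq D$ put $L_{D'}=\bigoplus_{d\in D'}L_d$. A unitary $D$-grading is a co-Galois grading if the $\ell$-primary component $D[\ell^\infty]$ is $0$ in case $\operatorname{char}K=\ell>0$, and every intermediate field $K\subseteq E\subseteq L$ is of the form $E=L_{D'}$ for some subgroup $D'\subseteq D$. -}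

module Defs where

open import Level using (Level; suc; _⊔_)
open import Algebra.Apartness.Bundles using (HeytingField; HeytingCommutativeRing)
open import Algebra.Bundles using (AbelianGroup; CommutativeRing; Group; Semiring)
import Algebra.Definitions as AlgebraDefinitions
import Algebra.Definitions.RawMonoid as RawMonoidDefinitions
import Algebra.Definitions.RawSemiring as RawSemiringDefinitions
open import Algebra.Morphism.Structures using (IsRingHomomorphism; IsRingIsomorphism)
import Algebra.Morphism.Construct.Composition as Composition
import Algebra.Morphism.Construct.Identity as Identity
open import Data.Fin.Base using (Fin)
open import Data.Integer.Base using (ℤ; +_; -[1+_])
open import Data.List.Base using (filter; upTo)
import Data.Nat.Base as ℕ
open import Data.Nat.Base using (ℕ)
open import Data.Nat.Divisibility using (_∣_; _∣?_)
open import Data.Nat.ListAction using (product)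
open import Data.Nat.Primality using (prime?)
open import Data.Product.Base using (Σ; ∃; ∃-syntax; _×_; _,_; proj₁; proj₂)
open import Data.Vec.Functional using (Vector)
open import Function.Base using (_∘_; id; _on_)
open import Function.Bundles using (Inverse; _⇔_)
open import Function.Definitions using (Injective)
open import Relation.Binary.Bundles using (Setoid)
import Relation.Binary.Construct.On as On
open import Relation.Binary.PropositionalEquality using (_≡_)
import Relation.Binary.PropositionalEquality.Properties as ≡
open import Relation.Nullary.Decidable using (_×-dec_; yes; no)
open import Relation.Unary using (Pred; _∈_; _≐_; U)

-- Under excluded middle, tightness makes `x # y` equivalent to ¬ (x ≈ y), so
-- Heyting fields are then exactly the commutative rings with 0 ≠ 1 in which
-- every nonzero element is invertible.
Field : (u : Level) → Set (suc u)
Field u = HeytingField u u u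

r : ℕ → ℕ
r n = product (filter (λ p → prime? p ×-dec (p ∣? n)) (upTo (ℕ.suc n)))

er : ℕ → ℕ
er n with 4 ∣? n
... | yes _ = 2 ℕ.* r n
... | no  _ = r n

module FieldNotions {u : Level} (F : Field u) where
  open HeytingField F public using (Carrier; _≈_; _+_; _*_; -_; 0#; 1#)

  commutativeRing : CommutativeRing u u
  commutativeRing =
    HeytingCommutativeRing.commutativeRing (HeytingField.heytingCommutativeRing F)

  open CommutativeRing commutativeRing public
    using (rawRing; semiring; setoid; refl; sym; trans)
  open RawSemiringDefinitions (Semiring.rawSemiring semiring) public using (_^_; sum)
    renaming (_×_ to _·_)

  IsUnit : Pred Carrier u
  IsUnit = AlgebraDefinitions.Invertible _≈_ 1# _*_

  μ : ℕ → Setoid u u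
  μ m = record
    { Carrier       = ∃[ x ] (IsUnit x × (x ^ m) ≈ 1#)
    ; _≈_           = _≈_ on proj₁
    ; isEquivalence = On.isEquivalence proj₁ (Setoid.isEquivalence setoid)
    }

  -- ℓ generates the kernel of ℤ → F.
  HasCharacteristic : ℕ → Set u
  HasCharacteristic ℓ = ∀ m → (m · 1# ≈ 0#) ⇔ (ℓ ∣ m)

μ : {u : Level} → ℕ → Field u → Setoid u u
μ m F = FieldNotions.μ F m

HasCardinality : {u : Level} → Setoid u u → ℕ → Set u
HasCardinality S m = Inverse S (≡.setoid (Fin m))

module _ {u : Level} (G : Group u u) where
  open Group G
  open RawMonoidDefinitions rawMonoid using () renaming (_×_ to _times_)

  power : Carrier → ℤ → Carrier
  power g (+ k)    = k times g
  power g -[1+ k ] = (ℕ.suc k times g) ⁻¹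

  IsCyclic : Set u
  IsCyclic = ∃[ g ] ∀ x → ∃[ k ] x ≈ power g k

record Subgroup {u : Level} (D : AbelianGroup u u) : Set (suc u) where
  open AbelianGroup D
  field
    member   : Pred Carrier u
    resp     : ∀ {d e} → d ≈ e → d ∈ member → e ∈ member
    ε-closed : ε ∈ member
    ∙-closed : ∀ {d e} → d ∈ member → e ∈ member → d ∙ e ∈ member
    ⁻¹-closed : ∀ {d} → d ∈ member → d ⁻¹ ∈ member

PrimaryComponent : {u : Level} (D : AbelianGroup u u) → ℕ → Pred (AbelianGroup.Carrier D) u
PrimaryComponent D ℓ d = ∃[ k ] ((ℓ ℕ.^ k) times d) ≈ ε
  where
  open AbelianGroup D
  open RawMonoidDefinitions rawMonoid using () renaming (_×_ to _times_)

-- K is identified with its image under ι, which is injective since K is a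
-- field and L is nontrivial.
record Extension {u : Level} (K L : Field u) : Set u where
  private
    module K = FieldNotions K
    module L = FieldNotions L
  field
    ι                  : K.Carrier → L.Carrier
    isRingHomomorphism : IsRingHomomorphism K.rawRing L.rawRing ι

module ExtensionNotions {u : Level} {K L : Field u} (L|K : Extension K L) where
  private
    module K = FieldNotions K
  open FieldNotions L hiding (μ)
  open Extension L|K
  private
    module LR = CommutativeRing commutativeRing

  Base : Pred Carrier u
  Base x = ∃[ k ] x ≈ ι k

  record HasDegree (n : ℕ) : Set u where
    field
      basis       : Vector Carrier n
      spanning    : ∀ x → Σ (Vector K.Carrier n) λ c →
                    x ≈ sum (λ i → ι (c i) * basis i)
      independent : ∀ (c : Vector K.Carrier n) →
                    sum (λ i → ι (c i) * basis i) ≈ 0# → ∀ i → c i K.≈ K.0#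

  record Automorphism : Set u where
    field
      σ                 : Carrier → Carrier
      isRingIsomorphism : IsRingIsomorphism rawRing rawRing σ
      fixes             : ∀ k → σ (ι k) ≈ ι k

    open IsRingIsomorphism isRingIsomorphism public

    σ⁻¹ : Carrier → Carrier
    σ⁻¹ y = proj₁ (surjective y)

    σ-σ⁻¹ : ∀ y → σ (σ⁻¹ y) ≈ y
    σ-σ⁻¹ y = proj₂ (surjective y) refl

    σ⁻¹-unique : ∀ {x y} → σ x ≈ y → σ⁻¹ y ≈ x
    σ⁻¹-unique {x} {y} p = injective (trans (σ-σ⁻¹ y) (sym p))

  private
    identity : Automorphism
    identity = record
      { σ                 = id
      ; isRingIsomorphism = Identity.isRingIsomorphism rawRing refl
      ; fixes             = λ _ → refl
      }

    compose : Automorphism → Automorphism → Automorphism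
    compose f g = record
      { σ                 = F.σ ∘ G.σ
      ; isRingIsomorphism =
          Composition.isRingIsomorphism trans G.isRingIsomorphism F.isRingIsomorphism
      ; fixes             = λ k → trans (F.⟦⟧-cong (G.fixes k)) (F.fixes k)
      }
      where
      module F = Automorphism f
      module G = Automorphism g

    inverse : Automorphism → Automorphism
    inverse f = record
      { σ                 = σ⁻¹
      ; isRingIsomorphism = record
        { isRingMonomorphism = record
          { isRingHomomorphism = record
            { isSemiringHomomorphism = record
              { isNearSemiringHomomorphism = record
                { +-isMonoidHomomorphism = record
                  { isMagmaHomomorphism = record
                    { isRelHomomorphism = record
                      { cong = λ p → σ⁻¹-unique (trans (σ-σ⁻¹ _) (sym p)) }
                    ; homo = λ x y → σ⁻¹-unique
                        (trans (+-homo _ _) (LR.+-cong (σ-σ⁻¹ x) (σ-σ⁻¹ y)))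
                    }
                  ; ε-homo = σ⁻¹-unique 0#-homo
                  }
                ; *-homo = λ x y → σ⁻¹-unique
                    (trans (*-homo _ _) (LR.*-cong (σ-σ⁻¹ x) (σ-σ⁻¹ y)))
                }
              ; 1#-homo = σ⁻¹-unique 1#-homo
              }
            ; -‿homo = λ x → σ⁻¹-unique (trans (-‿homo _) (LR.-‿cong (σ-σ⁻¹ x)))
            }
          ; injective = λ {x} {y} p →
              trans (sym (σ-σ⁻¹ x)) (trans (⟦⟧-cong p) (σ-σ⁻¹ y))
          }
        ; surjective = λ y → σ y , λ p → σ⁻¹-unique (sym p)
        }
      ; fixes = λ k → σ⁻¹-unique (fixes k)
      }
      where open Automorphism f

  Gal : Group u u
  Gal = record
    { Carrier = Automorphism
    ; _≈_     = λ f g → ∀ x → Automorphism.σ f x ≈ Automorphism.σ g x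
    ; _∙_     = compose
    ; ε       = identity
    ; _⁻¹     = inverse
    ; isGroup = record
      { isMonoid = record
        { isSemigroup = record
          { isMagma = record
            { isEquivalence = record
              { refl  = λ _ → refl
              ; sym   = λ p x → sym (p x)
              ; trans = λ p q x → trans (p x) (q x)
              }
            ; ∙-cong = λ {f} {_} {_} {k} p q x →
                trans (Automorphism.⟦⟧-cong f (q x)) (p (Automorphism.σ k x))
            }
          ; assoc = λ _ _ _ _ → refl
          }
        ; identity = (λ _ _ → refl) , (λ _ _ → refl)
        }
      ; inverse = (λ f x → Automorphism.σ⁻¹-unique f refl)
                , (λ f x → Automorphism.σ-σ⁻¹ f x)
      ; ⁻¹-cong = λ {f} {g} p x → Automorphism.σ⁻¹-unique f
          (trans (p _) (Automorphism.σ-σ⁻¹ g x))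
      }
    }

  -- The fixed field of Aut(L | K) is K. This is the Galois condition for
  -- algebraic extensions; it is only used together with finiteness.
  IsGalois : Set u
  IsGalois = ∀ x → (∀ f → Automorphism.σ f x ≈ x) → x ∈ Base

  record IsFiniteCyclic (n : ℕ) : Set u where
    field
      degree   : HasDegree n
      isGalois : IsGalois
      isCyclic : IsCyclic Gal

  record IntermediateField : Set (suc u) where
    field
      member     : Pred Carrier u
      resp       : ∀ {x y} → x ≈ y → x ∈ member → y ∈ member
      contains-K : ∀ k → ι k ∈ member
      +-closed   : ∀ {x y} → x ∈ member → y ∈ member → x + y ∈ member
      *-closed   : ∀ {x y} → x ∈ member → y ∈ member → x * y ∈ member
      -‿closed   : ∀ {x} → x ∈ member → (- x) ∈ member
      inv-closed : ∀ {x y} → x ∈ member → x * y ≈ 1# → y ∈ member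

  -- The subspace Σ_{d ∈ P} C d of L: elements x = y₁ + … + yₘ with
  -- yᵢ ∈ C dᵢ and dᵢ ∈ P. Repetitions among the dᵢ are allowed.
  FiniteSums : {p : Level} {D : Set u} →
               (D → Pred Carrier u) → Pred D p → Pred Carrier (u ⊔ p)
  FiniteSums {D = D} C P x =
    ∃[ m ] Σ (Vector D m) λ d → Σ (Vector Carrier m) λ y →
      (∀ i → d i ∈ P) × (∀ i → y i ∈ C (d i)) × x ≈ sum y

  -- L = ⊕_{d ∈ D} L_d, with L_d = component d, as an internal direct sum:
  -- `spanning` is L = Σ L_d, and `independent` says that homogeneous elements
  -- of pairwise distinct degrees summing to 0 all vanish.
  -- The group operation ∙ of D is the additive one of D.
  record Grading (D : AbelianGroup u u) : Set (suc u) where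
    private
      module D = AbelianGroup D
    field
      component : D.Carrier → Pred Carrier u
      resp      : ∀ {d e x y} → d D.≈ e → x ≈ y → x ∈ component d → y ∈ component e
      0-closed  : ∀ {d} → 0# ∈ component d
      +-closed  : ∀ {d x y} → x ∈ component d → y ∈ component d → x + y ∈ component d
      ·-closed  : ∀ {d x} k → x ∈ component d → ι k * x ∈ component d
      *-graded  : ∀ {d e x y} → x ∈ component d → y ∈ component e →
                  x * y ∈ component (d D.∙ e)
      spanning    : ∀ x → x ∈ FiniteSums component U
      independent : ∀ {m} (d : Vector D.Carrier m) (y : Vector Carrier m) →
                    Injective _≡_ D._≈_ d → (∀ i → y i ∈ component (d i)) →
                    sum y ≈ 0# → ∀ i → y i ≈ 0#

    L⟨_⟩ : Subgroup D → Pred Carrier u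
    L⟨ D′ ⟩ = FiniteSums component (Subgroup.member D′)

  record UnitaryGrading (D : AbelianGroup u u) : Set (suc u) where
    field
      grading     : Grading D
    open Grading grading public
    field
      component-0 : component (AbelianGroup.ε D) ≐ Base
      has-unit    : ∀ d → ∃[ x ] (x ∈ component d × IsUnit x)

  HasUnitaryGrading : Set (suc u)
  HasUnitaryGrading = ∃[ D ] UnitaryGrading D

  record IsCoGalois {D : AbelianGroup u u} (𝓛 : UnitaryGrading D) : Set (suc u) where
    open UnitaryGrading 𝓛 using (L⟨_⟩)
    open AbelianGroup D using () renaming (_≈_ to _≈ᴰ_; ε to εᴰ)
    field
      primary-trivial : ∀ ℓ → 0 ℕ.< ℓ → K.HasCharacteristic ℓ →
                        ∀ d → d ∈ PrimaryComponent D ℓ → d ≈ᴰ εᴰ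
      intermediate    : ∀ (E : IntermediateField) →
                        ∃[ D′ ] IntermediateField.member E ≐ L⟨ D′ ⟩

open ExtensionNotions public
  using (IsFiniteCyclic; UnitaryGrading; HasUnitaryGrading; IsCoGalois)

{-# OPTIONS --safe #-}

-- Let σ generate the Galois group; K is its fixed field and, by the theorems of Dedekind and Artin, σ has order n and
-- the fixed field of σ^m has dimension at most m over K.
--
-- In a unitary grading a homogeneous unit y of degree d has exactly as many conjugates as d has multiples: its powers
-- in distinct degrees are independent, and its conjugates differ by roots of unity.  Hence D has exponent n and, being
-- abelian, an element of order n.  If x is a unit of that degree, ζ = σx / x is a primitive n-th root of unity.  Write
-- σζ = ζ^(1+s).  For a prime p ∣ n the p-th roots of unity are too few to have p nontrivial conjugates, so p ∣ s; if
-- 4 ∣ n, then σ cannot invert the fourth roots of unity, as σ² would fix x^(n/4), so 4 ∣ s.  Therefore er n ∣ s and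
-- ζ^(n / er n) lies in K.  An intermediate field is the fixed field of some σ^m, which the powers of x^(n/m) span.
--
-- Conversely, if ζ is a primitive n-th root of unity and ζ^(n / er n) lies in K, then σζ = ζ^(1+s) with er n ∣ s, and
-- n divides 1 + (1+s) + … + (1+s)^(j−1) exactly when n divides j.  So ζ has norm 1, Hilbert 90 gives β with
-- ζ σβ = β, and β has n conjugates while β^n lies in K: the powers of β grade L by ℤ/n.
module Submission where

open import Defs
open import Level using (Level; Lift; lift; lower)
open import Algebra.Apartness.Bundles using (HeytingField)
open import Algebra.Bundles using (AbelianGroup; CommutativeMonoid; CommutativeRing; Group)
open import Algebra.Definitions.RawMonoid using () renaming (_×_ to times)
open import Algebra.Morphism.Structures using (IsRingHomomorphism; IsRingMonomorphism)
open import Axiom.ExcludedMiddle using (ExcludedMiddle)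
open import Data.Fin.Base as Fin using (Fin; zero; suc; toℕ; fromℕ<; punchIn; inject≤)
import Data.Fin.Properties as Fin
open import Data.Integer.Base using (+_; -[1+_])
open import Data.List.Base using (List; []; _∷_; filter; upTo)
open import Data.List.Membership.Propositional.Properties using (∈-filter⁺; ∈-upTo⁺)
open import Data.List.Relation.Unary.All as All using (All; []; _∷_)
import Data.List.Relation.Unary.All.Properties as All
open import Data.List.Relation.Unary.AllPairs using ([]; _∷_)
open import Data.List.Relation.Unary.Unique.Propositional using (Unique)
import Data.List.Relation.Unary.Unique.Propositional.Properties as Unique
open import Data.Nat.Base as ℕ using (ℕ; zero; suc; NonZero; _≤_; _<_; z≤n; s≤s; _%_; _/_)
open import Data.Nat.Coprimality as Coprime using (Coprime)
open import Data.Nat.DivMod using (m≡m%n+[m/n]*n; m%n<n; m*n%n≡0; %-distribˡ-+; %-distribˡ-*)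
open import Data.Nat.Divisibility
open import Data.Nat.GCD using (gcd; gcd[m,n]∣m; gcd[m,n]∣n; gcd-GCD; gcd[m,n]≡0⇒m≡0; module GCD; module Bézout)
open GCD using (GCD)
open import Data.Nat.Induction using (<-rec)
open import Data.Nat.ListAction using (product)
open import Data.Nat.ListAction.Properties using (∈⇒∣product)
open import Data.Nat.Primality using (Prime; prime?; prime[2]; ¬prime[1]; prime⇒nonZero; prime⇒nonTrivial; prime⇒irreducible; euclidsLemma; productOfPrimes≢0)
open import Data.Nat.Primality.Factorisation using (PrimeFactorisation; factorise; factorisationHasAllPrimeFactors)
import Data.Nat.Properties as ℕ
open import Data.Nat.Tactic.RingSolver using (solve-∀)
open import Data.Product.Base using (Σ; ∃-syntax; _×_; _,_; proj₁; proj₂)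
open import Data.Sum.Base using (_⊎_; inj₁; inj₂)
open import Data.Unit.Base using (tt)
open import Data.Vec.Functional using (Vector; tail; insertAt) renaming ([] to []ᵛ; _∷_ to _∷ᵛ_)
open import Data.Vec.Functional.Properties using (insertAt-lookup; insertAt-punchIn)
open import Function.Base using (_∘_)
open import Function.Bundles using (Inverse; Equivalence; _⇔_; mk⇔)
open import Function.Definitions using (Injective)
open import Relation.Binary.Definitions using (tri<; tri≈; tri>)
open import Relation.Binary.PropositionalEquality as ≡ using (_≡_; _≢_)
open import Relation.Nullary.Decidable using (Dec; yes; no; _×-dec_; decidable-stable)
open import Relation.Nullary.Negation using (¬_; contradiction)
open import Relation.Unary using (Pred; _∈_; U)

-- Prime divisors, `er`, and divisibility of the sums 1 + t + ... + t^(j-1)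

module Arithmetic where
  open import Data.Nat.Base using (_+_; _*_)

  prime-induction : ∀ {a} (P : ℕ → Set a) → P 1 →
    (∀ p n → Prime p → .{{NonZero n}} → P n → P (p * n)) → ∀ n → .{{NonZero n}} → P n
  prime-induction P P1 step n = ≡.subst P (≡.sym isFactorisation) (go factorsPrime)
    where
    open PrimeFactorisation (factorise n)
    go : ∀ {ps} → All Prime ps → P (product ps)
    go []         = P1
    go (pp ∷ pps) = step _ _ pp {{productOfPrimes≢0 pps}} (go pps)

  prime∣prime⇒≡ : ∀ {p q} → Prime p → Prime q → p ∣ q → p ≡ q
  prime∣prime⇒≡ pp pq p∣q with prime⇒irreducible pq p∣q
  ... | inj₁ ≡.refl = contradiction pp ¬prime[1]
  ... | inj₂ p≡q    = p≡q

  1-or-prime-factor : ∀ n → .{{NonZero n}} → n ≡ 1 ⊎ ∃[ p ] ∃[ m ] Prime p × n ≡ p * m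
  1-or-prime-factor n = prime-induction (λ n → n ≡ 1 ⊎ ∃[ p ] ∃[ m ] Prime p × n ≡ p * m)
    (inj₁ ≡.refl) (λ p m pp _ → inj₂ (p , m , pp , ≡.refl)) n

  cofactor-nonZero : ∀ {n q m} → .{{NonZero n}} → n ≡ q * m → NonZero m
  cofactor-nonZero {n} {q} n≡qm = ℕ.≢-nonZero λ { ≡.refl → ℕ.≢-nonZero⁻¹ n (≡.trans n≡qm (ℕ.*-zeroʳ q)) }

  prime-cofactor-< : ∀ {n p m} → .{{NonZero n}} → Prime p → n ≡ p * m → m < n
  prime-cofactor-< {p = p} {m} pp n≡pm = ≡.subst (m <_) (≡.trans (ℕ.*-comm m p) (≡.sym n≡pm))
    (ℕ.m<m*n m p {{cofactor-nonZero {q = p} n≡pm}} (ℕ.nonTrivial⇒n>1 p {{prime⇒nonTrivial pp}}))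

  coprime-by-primes : ∀ {m n} → .{{NonZero m}} → (∀ {p} → Prime p → p ∣ m → p ∣ n → p ≡ 1) → Coprime m n
  coprime-by-primes {m} noprime {d} (d∣m , d∣n) with 1-or-prime-factor d {{ℕ.≢-nonZero d≢0}}
    where
    d≢0 : d ≢ 0
    d≢0 ≡.refl = ℕ.≢-nonZero⁻¹ m (0∣⇒≡0 d∣m)
  ... | inj₁ d≡1 = d≡1
  ... | inj₂ (p , k , pp , ≡.refl) = contradiction
          (≡.subst Prime (noprime pp (∣-trans (m∣m*n k) d∣m) (∣-trans (m∣m*n k) d∣n)) pp) ¬prime[1]

  -- Once n = q · `product ps`, the next prime `p` must divide `q`, since it differs from every
  -- prime in `ps`.
  product-of-distinct-primes-∣ : ∀ {ps n} → Unique ps → All Prime ps → All (_∣ n) ps → product ps ∣ n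
  product-of-distinct-primes-∣ [] [] [] = 1∣ _
  product-of-distinct-primes-∣ {p ∷ ps} (p∉ ∷ unique) (pp ∷ pps) (p∣n ∷ ps∣n)
    with product-of-distinct-primes-∣ unique pps ps∣n
  ... | divides q ≡.refl with euclidsLemma q (product ps) pp p∣n
  ... | inj₁ p∣q  = *-monoˡ-∣ (product ps) p∣q
  ... | inj₂ p∣ps = contradiction ≡.refl (All.lookup p∉ (factorisationHasAllPrimeFactors pp p∣ps pps))

  private
    primeDivisors : ℕ → List ℕ
    primeDivisors n = filter (λ p → prime? p ×-dec (p ∣? n)) (upTo (suc n))

    primeDivisors-sound : ∀ n → All (λ p → Prime p × p ∣ n) (primeDivisors n)
    primeDivisors-sound n = All.all-filter (λ p → prime? p ×-dec (p ∣? n)) (upTo (suc n))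

    primeDivisors-unique : ∀ n → Unique (primeDivisors n)
    primeDivisors-unique n = Unique.filter⁺ (λ p → prime? p ×-dec (p ∣? n)) (Unique.upTo⁺ (suc n))

  prime∣r : ∀ {n p} → .{{NonZero n}} → Prime p → p ∣ n → p ∣ r n
  prime∣r {n} pp p∣n = ∈⇒∣product
    (∈-filter⁺ (λ p → prime? p ×-dec (p ∣? n)) (∈-upTo⁺ (s≤s (∣⇒≤ p∣n))) (pp , p∣n))

  r-least : ∀ {n m} → (∀ {p} → Prime p → p ∣ n → p ∣ m) → r n ∣ m
  r-least {n} h = product-of-distinct-primes-∣ (primeDivisors-unique n)
    (All.map proj₁ (primeDivisors-sound n)) (All.map (λ (pp , p∣n) → h pp p∣n) (primeDivisors-sound n))

  prime∣er : ∀ {n p} → .{{NonZero n}} → Prime p → p ∣ n → p ∣ er n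
  prime∣er {n} pp p∣n with 4 ∣? n
  ... | yes _ = ∣n⇒∣m*n 2 (prime∣r pp p∣n)
  ... | no  _ = prime∣r pp p∣n

  4∣er : ∀ {n} → .{{NonZero n}} → 4 ∣ n → 4 ∣ er n
  4∣er {n} 4∣n with 4 ∣? n
  ... | yes _   = *-monoʳ-∣ 2 (prime∣r prime[2] (∣-trans (divides 2 ≡.refl) 4∣n))
  ... | no  4∤n = contradiction 4∣n 4∤n

  -- If 4 ∣ n, write m = 4q. A prime dividing 4q divides 2q already, so `r n` divides 2q and
  -- `2 * r n` divides `m`.
  er-least : ∀ {n m} → (∀ {p} → Prime p → p ∣ n → p ∣ m) → (4 ∣ n → 4 ∣ m) → er n ∣ m
  er-least {n} h h₄ with 4 ∣? n
  ... | no  _   = r-least h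
  ... | yes 4∣n with h₄ 4∣n
  ... | divides q ≡.refl =
    ≡.subst (2 * r n ∣_) (double q) (*-monoʳ-∣ 2 (r-least λ pp p∣n → halve pp (h pp p∣n)))
    where
    double : ∀ q → 2 * (q * 2) ≡ q * 4
    double = solve-∀
    halve : ∀ {p} → Prime p → p ∣ q * 4 → p ∣ q * 2
    halve {p} pp p∣ with euclidsLemma (q * 2) 2 pp (≡.subst (p ∣_) (≡.sym (ℕ.*-assoc q 2 2)) p∣)
    ... | inj₁ p∣q2 = p∣q2
    ... | inj₂ p∣2  = ∣n⇒∣m*n q p∣2

  er∣ : ∀ n → er n ∣ n
  er∣ n = er-least (λ _ p∣n → p∣n) (λ 4∣n → 4∣n)

  -- geometric s j = 1 + t + … + t^(j−1) for t = 1 + s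
  geometric : ℕ → ℕ → ℕ
  geometric s zero    = 0
  geometric s (suc j) = 1 + (1 + s) * geometric s j

  -- The last `b` terms share the factor (1 + s)^a, written as `1 + s * geometric s a` by summing
  -- the geometric series.
  geometric-+ : ∀ s a b → geometric s (a + b) ≡ geometric s a + (1 + s * geometric s a) * geometric s b
  geometric-+ s zero    b = lemma s (geometric s b)
    where
    lemma : ∀ s x → x ≡ 0 + (1 + s * 0) * x
    lemma = solve-∀
  geometric-+ s (suc a) b rewrite geometric-+ s a b = lemma s (geometric s a) (geometric s b)
    where
    lemma : ∀ s x y → 1 + (1 + s) * (x + (1 + s * x) * y) ≡
                      (1 + (1 + s) * x) + (1 + s * (1 + (1 + s) * x)) * y
    lemma = solve-∀

  -- 1 + s * geometric s a is (1 + s) ^ a.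
  geometric-* : ∀ s a b → geometric s (a * b) ≡ geometric s a * geometric (s * geometric s a) b
  geometric-* s a zero    rewrite ℕ.*-zeroʳ a = ≡.sym (ℕ.*-zeroʳ (geometric s a))
  geometric-* s a (suc b)
    rewrite ℕ.*-suc a b | geometric-+ s a (a * b) | geometric-* s a b =
      lemma (geometric s a) (geometric (s * geometric s a) b) (s * geometric s a)
    where
    lemma : ∀ x y z → x + (1 + z) * (x * y) ≡ x * (1 + (1 + z) * y)
    lemma = solve-∀

  -- The binomial coefficient "j choose 2".
  triangular : ℕ → ℕ
  triangular zero    = 0
  triangular (suc j) = triangular j + j

  2*triangular : ∀ j → 2 * triangular j + j ≡ j * j
  2*triangular zero    = ≡.refl
  2*triangular (suc j) = ≡.trans (lemma₁ (triangular j) j)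
    (≡.trans (≡.cong (λ x → x + (j + j + 1)) (2*triangular j)) (lemma₂ j))
    where
    lemma₁ : ∀ x j → 2 * (x + j) + (1 + j) ≡ (2 * x + j) + (j + j + 1)
    lemma₁ = solve-∀
    lemma₂ : ∀ j → j * j + (j + j + 1) ≡ (1 + j) * (1 + j)
    lemma₂ = solve-∀

  -- The binomial expansion of ((1 + s)^j - 1) / s, explicit up to the terms divisible by s².
  geometric-expand : ∀ s j → ∃[ q ] geometric s j ≡ j + s * (triangular j + s * q)
  geometric-expand s zero    = 0 , lemma s
    where
    lemma : ∀ s → 0 ≡ s * (s * 0)
    lemma = solve-∀
  geometric-expand s (suc j) with geometric-expand s j
  ... | q , eq rewrite eq = q + triangular j + s * q , lemma s j (triangular j) q
    where
    lemma : ∀ s j x q → 1 + (1 + s) * (j + s * (x + s * q)) ≡ 1 + j + s * (x + j + s * (q + x + s * q))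
    lemma = solve-∀

  -- By the expansion, `geometric s j` is congruent to `j` modulo `s`, hence modulo `p`.
  ∣s⇒∣geometric : ∀ {p s} j → p ∣ s → p ∣ j → p ∣ geometric s j
  ∣s⇒∣geometric {p} {s} j p∣s p∣j with geometric-expand s j
  ... | _ , eq rewrite eq = ∣m∣n⇒∣m+n p∣j (∣m⇒∣m*n _ p∣s)

  ∣geometric⇒∣ : ∀ {p s} j → p ∣ s → p ∣ geometric s j → p ∣ j
  ∣geometric⇒∣ {p} {s} j p∣s p∣g with geometric-expand s j
  ... | q , eq rewrite eq = ∣m+n∣m⇒∣n {m = s * (triangular j + s * q)} (≡.subst (p ∣_) (ℕ.+-comm j _) p∣g) (∣m⇒∣m*n _ p∣s)

  -- One prime is split off at a time: `geometric-*` yields the factor `geometric s p`, divisible by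
  -- `p`, and a sum of the same kind whose new `s` is a multiple of the old one.
  n∣geometric-n : ∀ n → .{{NonZero n}} → ∀ s → (∀ {p} → Prime p → p ∣ n → p ∣ s) → n ∣ geometric s n
  n∣geometric-n = prime-induction _ (λ s _ → 1∣ _) λ p n pp ih s h →
    ≡.subst (p * n ∣_) (≡.sym (geometric-* s p n))
      (*-pres-∣ (∣s⇒∣geometric p (h pp (m∣m*n n)) ∣-refl)
                (ih (s * geometric s p) λ pq q∣n → ∣m⇒∣m*n _ (h pq (∣n⇒∣m*n p q∣n))))

  -- For odd `p`, `triangular p` is divisible by `p`, so `geometric s p` is `p` modulo p². For p = 2
  -- it is s + 2, and 4 ∣ s makes this 2 modulo 4.
  p²∤geometric : ∀ {p s} → Prime p → p ∣ s → (p ≡ 2 → 4 ∣ s) → p * p ∤ geometric s p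
  p²∤geometric {p} {s} pp p∣s h p²∣g with p ℕ.≟ 2
  ... | yes ≡.refl = contradiction (∣⇒≤ (∣m+n∣m⇒∣n (≡.subst (4 ∣_) (lemma s) p²∣g) (h ≡.refl))) λ { (s≤s (s≤s ())) }
    where
    lemma : ∀ s → 1 + (1 + s) * (1 + (1 + s) * 0) ≡ s + 2
    lemma = solve-∀
  ... | no p≢2 with geometric-expand s p
  ... | q , eq = ℕ.<⇒≱ p<p² (∣⇒≤ {{prime⇒nonZero pp}} p²∣p)
    where
    instance
      p≢0 = prime⇒nonZero pp
    p∣T : p ∣ triangular p
    p∣T with euclidsLemma 2 (triangular p) pp (∣m+n∣m⇒∣n {m = p}
               (≡.subst (p ∣_) (≡.trans (≡.sym (2*triangular p)) (ℕ.+-comm _ p)) (m∣m*n p)) ∣-refl)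
    ... | inj₂ p∣T = p∣T
    ... | inj₁ p∣2 = contradiction (prime∣prime⇒≡ pp prime[2] p∣2) p≢2
    p²∣p : p * p ∣ p
    p²∣p = ∣m+n∣m⇒∣n {m = s * (triangular p + s * q)} (≡.subst (p * p ∣_) (≡.trans eq (ℕ.+-comm p _)) p²∣g)
      (*-pres-∣ p∣s (∣m∣n⇒∣m+n p∣T (∣m⇒∣m*n q p∣s)))
    p<p² : p < p * p
    p<p² = ℕ.m<m*n p p (ℕ.nonTrivial⇒n>1 p {{prime⇒nonTrivial pp}})

  -- For n = p m, the factor geometric s p is p u with u prime to m, so that p can be cancelled.
  n∣geometric⇒n∣ : ∀ n → .{{NonZero n}} → ∀ s → (∀ {p} → Prime p → p ∣ n → p ∣ s) →
                   (4 ∣ n → 4 ∣ s) → ∀ j → n ∣ geometric s j → n ∣ j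
  n∣geometric⇒n∣ = prime-induction _ (λ _ _ _ j _ → 1∣ j) step
    where
    step : ∀ p n → Prime p → .{{NonZero n}} →
           (∀ s → (∀ {q} → Prime q → q ∣ n → q ∣ s) → (4 ∣ n → 4 ∣ s) → ∀ j → n ∣ geometric s j → n ∣ j) →
           ∀ s → (∀ {q} → Prime q → q ∣ p * n → q ∣ s) → (4 ∣ p * n → 4 ∣ s) →
           ∀ j → p * n ∣ geometric s j → p * n ∣ j
    step p n pp ih s h h₄ j pn∣g
      with ∣geometric⇒∣ j (h pp (m∣m*n n)) (∣-trans (m∣m*n n) pn∣g)
         | ∣s⇒∣geometric p (h pp (m∣m*n n)) ∣-refl
    ... | divides j′ ≡.refl | divides u gₚ≡up =
      ≡.subst (p * n ∣_) (ℕ.*-comm p j′) (*-monoʳ-∣ p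
        (ih s′ (λ pq q∣n → ∣m⇒∣m*n _ (h pq (∣n⇒∣m*n p q∣n))) (λ 4∣n → ∣m⇒∣m*n _ (h₄ (∣n⇒∣m*n p 4∣n))) j′
          (Coprime.coprime-divisor n⊥u (*-cancelˡ-∣ p {{prime⇒nonZero pp}} (≡.subst (p * n ∣_) factored pn∣g)))))
      where
      s′ = s * geometric s p
      factored : geometric s (j′ * p) ≡ p * (u * geometric s′ j′)
      factored = begin
        geometric s (j′ * p)            ≡⟨ ≡.cong (geometric s) (ℕ.*-comm j′ p) ⟩
        geometric s (p * j′)            ≡⟨ geometric-* s p j′ ⟩
        geometric s p * geometric s′ j′ ≡⟨ ≡.cong (_* geometric s′ j′) (≡.trans gₚ≡up (ℕ.*-comm u p)) ⟩
        p * u * geometric s′ j′         ≡⟨ ℕ.*-assoc p u _ ⟩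
        p * (u * geometric s′ j′)       ∎
        where open ≡.≡-Reasoning
      n⊥u : Coprime n u
      n⊥u = coprime-by-primes common
        where
        common : ∀ {q} → Prime q → q ∣ n → q ∣ u → q ≡ 1
        -- Such a `q` divides `geometric s p`, hence `p`. So q = p, and p² divides `geometric s p`;
        -- if p = 2, then 4 divides p n, which supplies 4 ∣ s.
        common {q} pq q∣n q∣u with prime∣prime⇒≡ pq pp (∣geometric⇒∣ p (h pq (∣n⇒∣m*n p q∣n))
                                     (≡.subst (q ∣_) (≡.sym gₚ≡up) (∣m⇒∣m*n p q∣u)))
        ... | ≡.refl = contradiction (≡.subst (p * p ∣_) (≡.sym gₚ≡up) (*-monoˡ-∣ p q∣u))
          (p²∤geometric pp (h pp (m∣m*n n)) λ { ≡.refl → h₄ (*-monoʳ-∣ 2 q∣n) })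

-- Classical search for natural numbers

module Choice (em : ∀ {a : Level} → ExcludedMiddle a) where

  least : ∀ {a} (P : ℕ → Set a) {n} → P n → ∃[ m ] P m × (∀ {j} → j < m → ¬ P j)
  least P {n} = <-rec (λ n → P n → ∃[ m ] P m × (∀ {j} → j < m → ¬ P j)) step n
    where
    step : ∀ n → (∀ {j} → j < n → P j → _) → P n → ∃[ m ] P m × (∀ {j} → j < m → ¬ P j)
    step n rec Pn with em {P = ∃[ j ] j < n × P j}
    ... | yes (j , j<n , Pj) = rec j<n Pj
    ... | no none            = n , Pn , λ j<n Pj → none (_ , j<n , Pj)

  -- Otherwise `P` would climb from 0 past the bound. This produces maximal independent families,
  -- the bound being one on their length.
  last-before-failure : ∀ {a} (P : ℕ → Set a) {b} → P 0 → (∀ {k} → P k → k ≤ b) → ∃[ k ] P k × ¬ P (suc k)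
  last-before-failure P {b} P0 bounded = decidable-stable em λ none →
    ℕ.1+n≰n (bounded (all (λ Pk → decidable-stable em λ ¬Psk → none (_ , Pk , ¬Psk)) (suc b)))
    where
    all : (∀ {k} → P k → P (suc k)) → ∀ k → P k
    all step zero    = P0
    all step (suc k) = step (all step k)

-- Orders of elements in a commutative monoid

module Orders {c ℓ : Level} (M : CommutativeMonoid c ℓ) where
  open CommutativeMonoid M
  open import Algebra.Properties.CommutativeMonoid.Mult M renaming (_×_ to _·_)
  open import Relation.Binary.Reasoning.Setoid setoid
  open Arithmetic

  -- A commutative monoid covers both the degrees of a grading and the elements of a field, whose
  -- powers are the multiples here.
  HasOrder : Carrier → ℕ → Set ℓ
  HasOrder g n = n · g ≈ ε × (∀ j → j · g ≈ ε → n ∣ j)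

  ·-ε : ∀ n → n · ε ≈ ε
  ·-ε zero    = refl
  ·-ε (suc n) = trans (identityˡ _) (·-ε n)

  multiple-·≈ε : ∀ {n j g} → n · g ≈ ε → n ∣ j → j · g ≈ ε
  multiple-·≈ε {n} {g = g} ng≈ε (divides q ≡.refl) =
    trans (sym (×-assocˡ g q n)) (trans (×-congʳ q ng≈ε) (·-ε q))

  -- Bézout's identity over ℕ is d + y b = x a or d + x a = y b; either form works without inverses.
  gcd-·≈ε : ∀ {a b d g} → GCD a b d → a · g ≈ ε → b · g ≈ ε → d · g ≈ ε
  gcd-·≈ε {a} {b} {d} {g} isGCD ag bg with Bézout.identity isGCD
  ... | Bézout.+- x y eq = begin
    d · g                   ≈⟨ identityʳ _ ⟨
    d · g ∙ ε               ≈⟨ ∙-congˡ (multiple-·≈ε bg (n∣m*n y)) ⟨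
    d · g ∙ (y ℕ.* b) · g   ≈⟨ ×-homo-+ g d (y ℕ.* b) ⟨
    (d ℕ.+ y ℕ.* b) · g     ≡⟨ ≡.cong (_· g) eq ⟩
    (x ℕ.* a) · g           ≈⟨ multiple-·≈ε ag (n∣m*n x) ⟩
    ε                       ∎
  ... | Bézout.-+ x y eq = begin
    d · g                   ≈⟨ identityʳ _ ⟨
    d · g ∙ ε               ≈⟨ ∙-congˡ (multiple-·≈ε ag (n∣m*n x)) ⟨
    d · g ∙ (x ℕ.* a) · g   ≈⟨ ×-homo-+ g d (x ℕ.* a) ⟨
    (d ℕ.+ x ℕ.* a) · g     ≡⟨ ≡.cong (_· g) eq ⟩
    (y ℕ.* b) · g           ≈⟨ multiple-·≈ε bg (n∣m*n y) ⟩
    ε                       ∎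

  coprime-·≈ε : ∀ {a b g} → Coprime a b → a · g ≈ ε → b · g ≈ ε → g ≈ ε
  coprime-·≈ε {g = g} a⊥b ag bg =
    trans (sym (×-homo-1 g)) (gcd-·≈ε (Coprime.coprime⇒GCD≡1 a⊥b) ag bg)

  -- If `j · g ≈ ε`, then d = gcd n j annihilates `g` too. Were n / d not 1, it would have a prime
  -- factor `p`, and n / p, a multiple of d, would annihilate `g`.
  hasOrder-by-primes : ∀ {n g} → .{{NonZero n}} → n · g ≈ ε →
                       (∀ {p m} → Prime p → n ≡ p ℕ.* m → ¬ m · g ≈ ε) → HasOrder g n
  hasOrder-by-primes {n} {g} ng≈ε h = ng≈ε , order∣
    where
    order∣ : ∀ j → j · g ≈ ε → n ∣ j
    order∣ j jg≈ε with gcd[m,n]∣m n j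
    ... | divides q n≡qd with 1-or-prime-factor q {{q≢0}}
      where
      q≢0 : NonZero q
      q≢0 = ℕ.≢-nonZero λ { ≡.refl → ℕ.≢-nonZero⁻¹ n n≡qd }
    ... | inj₁ ≡.refl = ≡.subst (_∣ j) (≡.sym (≡.trans n≡qd (ℕ.*-identityˡ _))) (gcd[m,n]∣n n j)
    ... | inj₂ (p , m , pp , ≡.refl) = contradiction
      (multiple-·≈ε (gcd-·≈ε (gcd-GCD n j) ng≈ε jg≈ε) (n∣m*n m))
      (h pp (≡.trans n≡qd (ℕ.*-assoc p m _)))

  order-minimal : ∀ {n g} → HasOrder g n → ∀ {j} → 0 < j → j < n → ¬ j · g ≈ ε
  order-minimal (_ , order∣) {j} 0<j j<n jg≈ε = ℕ.<⇒≱ j<n (∣⇒≤ {{ℕ.>-nonZero 0<j}} (order∣ j jg≈ε))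

  module _ {n : ℕ} {g : Carrier} (cancel : ∀ i {x y} → i · g ∙ x ≈ i · g ∙ y → x ≈ y)
    (minimal : ∀ {j} → 0 < j → j < n → ¬ j · g ≈ ε) where

    -- Cancelling `i · g` leaves `(j ∸ i) · g ≈ ε`. Cancellation is asked for multiples of `g`
    -- alone, since 0 cannot be cancelled in a field.
    multiples-distinct : ∀ {i j} → i < j → j < n → ¬ i · g ≈ j · g
    multiples-distinct {i} {j} i<j j<n eq = minimal (ℕ.m<n⇒0<n∸m i<j) (ℕ.≤-<-trans (ℕ.m∸n≤m j i) j<n) (cancel i (begin
      i · g ∙ (j ℕ.∸ i) · g ≈⟨ ×-homo-+ g i (j ℕ.∸ i) ⟨
      (i ℕ.+ (j ℕ.∸ i)) · g ≡⟨ ≡.cong (_· g) (ℕ.m+[n∸m]≡n (ℕ.<⇒≤ i<j)) ⟩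
      j · g                 ≈⟨ eq ⟨
      i · g                 ≈⟨ identityʳ _ ⟨
      i · g ∙ ε             ∎))

    multiples-injective : ∀ {i j} → i < n → j < n → i · g ≈ j · g → i ≡ j
    multiples-injective {i} {j} i<n j<n eq with ℕ.<-cmp i j
    ... | tri< i<j _ _ = contradiction eq (multiples-distinct i<j j<n)
    ... | tri≈ _ i≡j _ = i≡j
    ... | tri> _ _ j<i = contradiction (sym eq) (multiples-distinct j<i i<n)

  -- For m = n / p this says that p divides the order of g as often as it divides n.
  FullAt : ℕ → Carrier → ℕ → Set ℓ
  FullAt n g p = ∀ m → n ≡ p ℕ.* m → ¬ m · g ≈ ε

  module _ (em : ExcludedMiddle ℓ) where

    -- If g is not yet full at q, adding (product ps) · g′ makes it so and changes nothing at the primes ps.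
    element-of-order : ∀ n → .{{NonZero n}} →
      (∀ {p} m → Prime p → n ≡ p ℕ.* m → ∃[ g ] (n · g ≈ ε × ¬ m · g ≈ ε)) → ∃[ g ] HasOrder g n
    element-of-order n h with full factorsPrime (All.tabulate λ p∈ → ≡.subst (_ ∣_) (≡.sym isFactorisation) (∈⇒∣product p∈))
      where
      open PrimeFactorisation (factorise n)
      full : ∀ {ps} → All Prime ps → All (_∣ n) ps → ∃[ g ] (n · g ≈ ε × All (FullAt n g) ps)
      full [] [] = ε , ·-ε n , []
      full {q ∷ ps} (pq ∷ pps) (divides m n≡mq ∷ ps∣n) with full pps ps∣n
      ... | g , ng≈ε , full-ps with em {m · g ≈ ε}
      ... | no  mg≉ε = g , ng≈ε , full-q ∷ full-ps
        where
        full-q : FullAt n g q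
        full-q m′ n≡qm′ m′g≈ε = mg≉ε (≡.subst (λ k → k · g ≈ ε)
          (ℕ.*-cancelˡ-≡ m′ m q {{prime⇒nonZero pq}} (≡.trans (≡.sym n≡qm′) (≡.trans n≡mq (ℕ.*-comm m q)))) m′g≈ε)
      ... | yes mg≈ε with h m pq (≡.trans n≡mq (ℕ.*-comm m q))
      -- For p in `ps` with n = p m′, `n` divides m′ · `product ps`. So `m′ · f` vanishes and
      -- fullness at p passes from `g` to `g ∙ f`.
      ... | g′ , ng′≈ε , mg′≉ε = g ∙ f , nh≈ε , full-q ∷ All.tabulate λ p∈ps m′ n≡pm′ m′h≈ε →
              All.lookup full-ps p∈ps m′ n≡pm′ (trans (sym (identityʳ _)) (trans
                (∙-congˡ (sym (·f m′ (≡.subst (_∣ m′ ℕ.* product ps) (≡.sym (≡.trans n≡pm′ (ℕ.*-comm _ m′)))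
                  (*-monoʳ-∣ m′ (∈⇒∣product p∈ps))))))
                (trans (sym (×-distrib-+ g f m′)) m′h≈ε)))
        where
        f = product ps · g′
        ·f : ∀ k → n ∣ k ℕ.* product ps → k · f ≈ ε
        ·f k n∣ = trans (×-assocˡ g′ k (product ps)) (multiple-·≈ε ng′≈ε n∣)
        nh≈ε : n · (g ∙ f) ≈ ε
        nh≈ε = trans (×-distrib-+ g f n) (trans (∙-cong ng≈ε (·f n (m∣m*n _))) (identityˡ ε))
        q∤ps : q ∤ product ps
        q∤ps q∣ps = All.lookup full-ps (factorisationHasAllPrimeFactors pq q∣ps pps) m (≡.trans n≡mq (ℕ.*-comm m q)) mg≈ε
        q⊥ps : Coprime q (product ps)
        q⊥ps = coprime-by-primes {{prime⇒nonZero pq}} λ pp p∣q p∣ps →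
          contradiction (≡.subst (_∣ product ps) (prime∣prime⇒≡ pp pq p∣q) p∣ps) q∤ps
        full-q : FullAt n (g ∙ f) q
        full-q m′ n≡qm′ m′h≈ε with ℕ.*-cancelˡ-≡ m′ m q {{prime⇒nonZero pq}}
                                     (≡.trans (≡.sym n≡qm′) (≡.trans n≡mq (ℕ.*-comm m q)))
        -- `m · g′` is annihilated by `q`, because q m = n, and by `product ps`, because `m · g` and
        -- `m · (g ∙ f)` vanish.
        ... | ≡.refl = mg′≉ε (coprime-·≈ε q⊥ps
          (trans (×-assocˡ g′ q m) (≡.subst (λ k → k · g′ ≈ ε) n≡qm′ ng′≈ε))
          (trans (×-assocˡ g′ (product ps) m) (trans (reflexive (≡.cong (_· g′) (ℕ.*-comm (product ps) m)))
            (trans (sym (×-assocˡ g′ m (product ps))) (begin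
              m · f             ≈⟨ identityˡ _ ⟨
              ε ∙ m · f         ≈⟨ ∙-congʳ mg≈ε ⟨
              m · g ∙ m · f     ≈⟨ ×-distrib-+ g f m ⟨
              m · (g ∙ f)       ≈⟨ m′h≈ε ⟩
              ε                 ∎)))))
    ... | g , ng≈ε , full-ps = g , hasOrder-by-primes ng≈ε λ {p} {m} pp n≡pm →
      All.lookup full-ps (factorisationHasAllPrimeFactors pp
        (≡.subst (p ∣_) (≡.trans (≡.sym n≡pm) isFactorisation) (m∣m*n m)) factorsPrime) m n≡pm
      where open PrimeFactorisation (factorise n)

-- Linear systems, polynomials and roots of unity over a field

module FieldTheory (em : ∀ {a : Level} → ExcludedMiddle a) {u : Level} (F : Field u) where
  open Arithmetic
  open FieldNotions F hiding (μ) public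
  open HeytingField F using (_#_; tight; #⇒invertible; invertible⇒#; #-irrefl)
  open CommutativeRing commutativeRing public
    using ( +-cong; +-congˡ; +-congʳ; +-assoc; +-comm; +-identityˡ; +-identityʳ; -‿inverseˡ; -‿inverseʳ
          ; *-cong; *-congˡ; *-congʳ; *-assoc; *-comm; *-identityˡ; *-identityʳ; distribˡ; distribʳ; zeroˡ; zeroʳ
          ; reflexive; *-commutativeMonoid; commutativeSemiring; ring; +-group; +-commutativeMonoid; -‿cong)
  open import Algebra.Properties.Semiring.Sum semiring public
    using (sum-cong-≋; sum-remove; ∑-distrib-+; ∑-comm; *-distribˡ-sum; *-distribʳ-sum; sum-replicate-zero; sum-replicate)
  open import Algebra.Properties.CommutativeSemiring.Exp commutativeSemiring public
    using (^-congˡ; ^-homo-*; ^-assocʳ; ^-distrib-*)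
  open import Algebra.Properties.Ring ring public using (-‿distribʳ-*)
  open import Algebra.Solver.Ring.NaturalCoefficients.Default commutativeSemiring public
    using (solve; _:+_; _:*_; _:=_; con)
  open import Algebra.Properties.CommutativeSemigroup (CommutativeMonoid.commutativeSemigroup *-commutativeMonoid) public
    using (x∙yz≈y∙xz; interchange)
  module Mul = Orders *-commutativeMonoid
  open Mul public using (HasOrder)
  open import Algebra.Properties.Group +-group using (∙-cancelʳ)
  open import Relation.Binary.Reasoning.Setoid setoid

  dec : ∀ {a} (P : Set a) → Dec P
  dec P = em

  infix 4 _≉_
  _≉_ : Carrier → Carrier → Set u
  x ≉ y = ¬ x ≈ y

  ≈-stable : ∀ {x y} → ¬ x ≉ y → x ≈ y
  ≈-stable = decidable-stable em

  x-0≈x : ∀ x → x + - 0# ≈ x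
  x-0≈x x = trans (+-congˡ (trans (sym (+-identityˡ _)) (-‿inverseʳ 0#))) (+-identityʳ x)

  -- By tightness a nonzero `x` is apart from 0, and apartness makes the difference x - 0
  -- invertible.
  ≉0⇒unit : ∀ {x} → x ≉ 0# → IsUnit x
  ≉0⇒unit {x} x≉0 with dec (x # 0#)
  ... | no ¬x#0 = contradiction (proj₁ (tight x 0#) ¬x#0) x≉0
  ... | yes x#0 with #⇒invertible x#0
  ... | y , yx≈1 , xy≈1 = y , trans (*-congˡ (sym (x-0≈x x))) yx≈1 , trans (*-congʳ (sym (x-0≈x x))) xy≈1

  -- If 1 = 0, the difference 0 - 0 would be invertible, which makes 0 apart from itself.
  1≉0 : 1# ≉ 0#
  1≉0 1≈0 = #-irrefl refl (invertible⇒# {0#} {0#} (0# , trans (zeroˡ _) (sym 1≈0) , trans (zeroʳ _) (sym 1≈0)))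

  unit⇒≉0 : ∀ {x} → IsUnit x → x ≉ 0#
  unit⇒≉0 (y , yx≈1 , _) x≈0 = 1≉0 (trans (sym yx≈1) (trans (*-congˡ x≈0) (zeroʳ y)))

  invert : ∀ {x} → x ≉ 0# → ∃[ y ] x * y ≈ 1#
  invert x≉0 with ≉0⇒unit x≉0
  ... | y , _ , xy≈1 = y , xy≈1

  *-cancelˡ : ∀ {x y z} → x ≉ 0# → x * y ≈ x * z → y ≈ z
  *-cancelˡ {x} {y} {z} x≉0 xy≈xz with ≉0⇒unit x≉0
  ... | w , wx≈1 , _ = begin
    y           ≈⟨ trans (sym (*-identityˡ y)) (*-congʳ (sym wx≈1)) ⟩
    w * x * y   ≈⟨ *-assoc w x y ⟩
    w * (x * y) ≈⟨ *-congˡ xy≈xz ⟩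
    w * (x * z) ≈⟨ *-assoc w x z ⟨
    w * x * z   ≈⟨ trans (*-congʳ wx≈1) (*-identityˡ z) ⟩
    z           ∎

  *-cancelʳ : ∀ {x y z} → x ≉ 0# → y * x ≈ z * x → y ≈ z
  *-cancelʳ x≉0 yx≈zx = *-cancelˡ x≉0 (trans (*-comm _ _) (trans yx≈zx (*-comm _ _)))

  *≈0⇒ : ∀ {x y} → x * y ≈ 0# → x ≉ 0# → y ≈ 0#
  *≈0⇒ xy≈0 x≉0 = *-cancelˡ x≉0 (trans xy≈0 (sym (zeroʳ _)))

  *-≉0 : ∀ {x y} → x ≉ 0# → y ≉ 0# → x * y ≉ 0#
  *-≉0 x≉0 y≉0 xy≈0 = y≉0 (*≈0⇒ xy≈0 x≉0)

  ^-≉0 : ∀ {x} n → x ≉ 0# → x ^ n ≉ 0#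
  ^-≉0 zero    _   = 1≉0
  ^-≉0 (suc n) x≉0 = *-≉0 x≉0 (^-≉0 n x≉0)

  *-separates : ∀ {x y z} → x ≉ y → x * z ≈ y * z → z ≈ 0#
  *-separates x≉y xz≈yz = ≈-stable λ z≉0 → x≉y (*-cancelʳ z≉0 xz≈yz)

  equal-squares : ∀ {x y} → x * x ≈ y * y → x ≈ y ⊎ x + y ≈ 0#
  equal-squares {x} {y} x²≈y² with dec (x ≈ y)
  ... | yes x≈y = inj₁ x≈y
  ... | no  x≉y = inj₂ (*-separates x≉y (begin
    x * (x + y)     ≈⟨ distribˡ x x y ⟩
    x * x + x * y   ≈⟨ +-cong x²≈y² (*-comm x y) ⟩
    y * y + y * x   ≈⟨ trans (+-comm _ _) (sym (distribˡ y x y)) ⟩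
    y * (x + y)     ∎))

  root-of-unity≉0 : ∀ {x} n → .{{NonZero n}} → x ^ n ≈ 1# → x ≉ 0#
  root-of-unity≉0 (suc n) xⁿ≈1 x≈0 = 1≉0 (trans (sym xⁿ≈1) (trans (*-congʳ x≈0) (zeroˡ _)))

  sum-zero : ∀ {n} {f : Vector Carrier n} → (∀ i → f i ≈ 0#) → sum f ≈ 0#
  sum-zero {n} f≈0 = trans (sum-cong-≋ f≈0) (sum-replicate-zero n)

  -- Gaussian elimination. A zero first row is dropped; otherwise a pivot in column `p` removes that
  -- unknown from the other rows, and the value `w` put back at `p` is the one that satisfies the
  -- first row.
  homogeneous-system : ∀ {m k} → m < k → (A : Fin m → Fin k → Carrier) →
    Σ (Vector Carrier k) λ c → (∃[ i ] c i ≉ 0#) × (∀ j → sum (λ i → A j i * c i) ≈ 0#)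
  homogeneous-system {zero}  {suc k} _         A = (λ _ → 1#) , (zero , 1≉0) , λ ()
  homogeneous-system {suc m} {suc k} (s≤s m<k) A with dec (∃[ p ] A zero p ≉ 0#)
  ... | no row≈0 with homogeneous-system (ℕ.m<n⇒m<1+n m<k) (A ∘ suc)
  ... | c , c≉0 , eqs = c , c≉0 , λ
    { zero    → sum-zero {f = λ i → A zero i * c i} λ i → trans (*-congʳ (≈-stable λ a≉0 → row≈0 (i , a≉0))) (zeroˡ _)
    ; (suc j) → eqs j }
  homogeneous-system {suc m} {suc k} (s≤s m<k) A | yes (p , a≉0) with invert a≉0
  ... | a⁻¹ , aa⁻¹≈1 with homogeneous-system m<k
    (λ j i → A (suc j) (punchIn p i) + (A (suc j) p * - a⁻¹) * A zero (punchIn p i))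
  ... | c , (i , c≉0) , eqs = insertAt c p w , (punchIn p i , c≉0 ∘ trans (reflexive (≡.sym (insertAt-punchIn c p w i)))) , rows
    where
    s = sum (λ i → A zero (punchIn p i) * c i)
    w = - a⁻¹ * s
    split : ∀ j → sum (λ i → A j i * insertAt c p w i) ≈ A j p * w + sum (λ i → A j (punchIn p i) * c i)
    split j = trans (sum-remove {i = p} (λ i → A j i * insertAt c p w i)) (+-cong
      (*-congˡ (reflexive (insertAt-lookup c p w)))
      (sum-cong-≋ λ i → *-congˡ (reflexive (insertAt-punchIn c p w i))))
    rows : ∀ j → sum (λ i → A j i * insertAt c p w i) ≈ 0#
    rows zero = begin
      sum (λ i → A zero i * insertAt c p w i) ≈⟨ split zero ⟩
      A zero p * (- a⁻¹ * s) + s ≈⟨ +-congʳ (*-assoc _ _ _) ⟨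
      A zero p * - a⁻¹ * s + s   ≈⟨ +-cong (*-congʳ (trans (sym (-‿distribʳ-* _ _)) (-‿cong aa⁻¹≈1))) (sym (*-identityˡ s)) ⟩
      - 1# * s + 1# * s          ≈⟨ distribʳ s _ _ ⟨
      (- 1# + 1#) * s            ≈⟨ *-congʳ (-‿inverseˡ 1#) ⟩
      0# * s                     ≈⟨ zeroˡ s ⟩
      0#                         ∎
    rows (suc j) = begin
      sum (λ i → A (suc j) i * insertAt c p w i) ≈⟨ split (suc j) ⟩
      e * (- a⁻¹ * s) + sum (λ i → A (suc j) (punchIn p i) * c i)
        ≈⟨ trans (+-comm _ _) (+-congˡ (trans (sym (*-assoc _ _ _)) (*-distribˡ-sum f t))) ⟩
      sum (λ i → A (suc j) (punchIn p i) * c i) + sum (λ i → f * (A zero (punchIn p i) * c i))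
        ≈⟨ ∑-distrib-+ (λ i → A (suc j) (punchIn p i) * c i) (λ i → f * t i) ⟨
      sum (λ i → A (suc j) (punchIn p i) * c i + f * (A zero (punchIn p i) * c i))
        ≈⟨ sum-cong-≋ (λ i → trans (+-congˡ (sym (*-assoc _ _ _))) (sym (distribʳ (c i) (A (suc j) (punchIn p i)) (f * A zero (punchIn p i))))) ⟩
      sum (λ i → (A (suc j) (punchIn p i) + f * A zero (punchIn p i)) * c i) ≈⟨ eqs j ⟩
      0#                         ∎
      where
      e = A (suc j) p
      f = e * - a⁻¹
      t = λ i → A zero (punchIn p i) * c i

  eval : ∀ {k} → Vector Carrier k → Carrier → Carrier
  eval c x = sum (λ i → c i * x ^ toℕ i)

  horner : ∀ {k} (c : Vector Carrier (suc k)) x → eval c x ≈ c zero + x * eval (tail c) x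
  horner c x = +-cong (*-identityʳ _) (trans (sum-cong-≋ λ i → x∙yz≈y∙xz (c (suc i)) x (x ^ toℕ i))
    (sym (*-distribˡ-sum x λ i → c (suc i) * x ^ toℕ i)))

  -- Synthetic division by X - ρ.
  quotient-by : ∀ {k} → Carrier → Vector Carrier (suc k) → Vector Carrier k
  quotient-by {suc k} ρ c = eval (tail c) ρ ∷ᵛ quotient-by ρ (tail c)

  -- The identity c(X) = (X - ρ) q(X) + c(ρ), arranged without subtraction.
  quotient-by-eval : ∀ {k} ρ (c : Vector Carrier (suc k)) x →
    eval c x + ρ * eval (quotient-by ρ c) x ≈ x * eval (quotient-by ρ c) x + eval c ρ
  quotient-by-eval {zero}  ρ c x = solve 3 (λ c ρ x → c :* con 1 :+ con 0 :+ ρ :* con 0 := x :* con 0 :+ (c :* con 1 :+ con 0))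
                                     refl (c zero) ρ x
  quotient-by-eval {suc k} ρ c x = begin
    eval c x + ρ * eval (quotient-by ρ c) x
      ≈⟨ +-cong (horner c x) (*-congˡ (horner (quotient-by ρ c) x)) ⟩
    c zero + x * E + ρ * (R + x * Q)
      ≈⟨ solve 6 (λ c x E ρ R Q → c :+ x :* E :+ ρ :* (R :+ x :* Q) := c :+ ρ :* R :+ x :* (E :+ ρ :* Q)) refl (c zero) x E ρ R Q ⟩
    c zero + ρ * R + x * (E + ρ * Q)
      ≈⟨ +-congˡ (*-congˡ (quotient-by-eval ρ (tail c) x)) ⟩
    c zero + ρ * R + x * (x * Q + R)
      ≈⟨ solve 5 (λ c ρ R x Q → c :+ ρ :* R :+ x :* (x :* Q :+ R) := x :* (R :+ x :* Q) :+ (c :+ ρ :* R)) refl (c zero) ρ R x Q ⟩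
    x * (R + x * Q) + (c zero + ρ * R)
      ≈⟨ +-cong (*-congˡ (horner (quotient-by ρ c) x)) (horner c ρ) ⟨
    x * eval (quotient-by ρ c) x + eval c ρ ∎
    where
    E = eval (tail c) x
    R = eval (tail c) ρ
    Q = eval (quotient-by ρ (tail c)) x

  quotient-by≈0⇒≈0 : ∀ {k} ρ (c : Vector Carrier (suc k)) →
    (∀ i → quotient-by ρ c i ≈ 0#) → eval c ρ ≈ 0# → ∀ i → c i ≈ 0#
  quotient-by≈0⇒≈0 {zero} ρ c _ c[ρ]≈0 zero = trans (sym (trans (+-identityʳ _) (*-identityʳ _))) c[ρ]≈0
  quotient-by≈0⇒≈0 {suc k} ρ c q≈0 c[ρ]≈0 = λ { zero → c₀≈0 ; (suc i) → quotient-by≈0⇒≈0 ρ (tail c) (q≈0 ∘ suc) (q≈0 zero) i }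
    where
    c₀≈0 : c zero ≈ 0#
    c₀≈0 = begin
      c zero                       ≈⟨ trans (sym (+-identityʳ _)) (+-congˡ (sym (trans (*-congˡ (q≈0 zero)) (zeroʳ ρ)))) ⟩
      c zero + ρ * eval (tail c) ρ ≈⟨ horner c ρ ⟨
      eval c ρ                     ≈⟨ c[ρ]≈0 ⟩
      0#                           ∎

  -- The quotient by X - `ρ zero` vanishes at the remaining points, so by induction it is zero, and
  -- so is the remainder.
  vanishing-polynomial : ∀ {k} (c : Vector Carrier k) {ρ : Vector Carrier k} → Injective _≡_ _≈_ ρ →
    (∀ j → eval c (ρ j) ≈ 0#) → ∀ i → c i ≈ 0#
  vanishing-polynomial {suc k} c {ρ} ρ-inj c[ρ]≈0 =
    quotient-by≈0⇒≈0 (ρ zero) c (vanishing-polynomial (quotient-by (ρ zero) c) (Fin.suc-injective ∘ ρ-inj) q[ρ]≈0) (c[ρ]≈0 zero)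
    where
    q[ρ]≈0 : ∀ j → eval (quotient-by (ρ zero) c) (ρ (suc j)) ≈ 0#
    q[ρ]≈0 j = *-separates {ρ zero} {ρ (suc j)} (λ eq → contradiction (ρ-inj eq) λ ()) (begin
      ρ zero * Q                    ≈⟨ trans (sym (+-identityˡ _)) (+-congʳ (sym (c[ρ]≈0 (suc j)))) ⟩
      eval c (ρ (suc j)) + ρ zero * Q ≈⟨ quotient-by-eval (ρ zero) c (ρ (suc j)) ⟩
      ρ (suc j) * Q + eval c (ρ zero) ≈⟨ trans (+-congˡ (c[ρ]≈0 zero)) (+-identityʳ _) ⟩
      ρ (suc j) * Q                 ∎)
      where Q = eval (quotient-by (ρ zero) c) (ρ (suc j))

  monomial : ∀ k → Vector Carrier (suc k)
  monomial zero    = λ _ → 1#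
  monomial (suc k) = 0# ∷ᵛ monomial k

  eval-monomial : ∀ k x → eval (monomial k) x ≈ x ^ k
  eval-monomial zero    x = trans (+-identityʳ _) (*-identityˡ _)
  eval-monomial (suc k) x = trans (horner (monomial (suc k)) x) (trans (+-identityˡ _) (*-congˡ (eval-monomial k x)))

  roots-of-unity-bound : ∀ {k n} → .{{NonZero n}} → {ρ : Vector Carrier k} → Injective _≡_ _≈_ ρ →
    (∀ i → ρ i ^ n ≈ 1#) → k ≤ n
  roots-of-unity-bound {k} {suc n} {ρ = ρ} ρ-inj ρⁿ≈1 with k ℕ.≤? suc n
  ... | yes k≤n = k≤n
  ... | no  k≰n = contradiction -1≈0 -1≉0
    where
    n<k = ℕ.≰⇒> k≰n
    -1≉0 : - 1# ≉ 0#
    -1≉0 -1≈0 = 1≉0 (trans (sym (+-identityʳ _)) (trans (+-congˡ (sym -1≈0)) (-‿inverseʳ 1#)))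
    -1≈0 : - 1# ≈ 0#
    -- X^(suc n) - 1 has `suc (suc n)` coefficients and would vanish at as many of the given points,
    -- so its constant coefficient would be 0.
    -1≈0 = vanishing-polynomial (- 1# ∷ᵛ monomial n) {λ i → ρ (inject≤ i n<k)}
      (Fin.inject≤-injective n<k n<k _ _ ∘ ρ-inj)
      (λ j → trans (horner (- 1# ∷ᵛ monomial n) _) (trans (+-congˡ (trans (*-congˡ (eval-monomial n _)) (ρⁿ≈1 _))) (-‿inverseˡ 1#)))
      zero

  ∷-injective : ∀ {k x} {ρ : Vector Carrier k} → Injective _≡_ _≈_ ρ → (∀ i → x ≉ ρ i) → Injective _≡_ _≈_ (x ∷ᵛ ρ)
  ∷-injective ρ-inj x≉ρ {zero}  {zero}  _  = ≡.refl
  ∷-injective ρ-inj x≉ρ {zero}  {suc j} eq = contradiction eq (x≉ρ j)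
  ∷-injective ρ-inj x≉ρ {suc i} {zero}  eq = contradiction (sym eq) (x≉ρ i)
  ∷-injective ρ-inj x≉ρ {suc i} {suc j} eq = ≡.cong suc (ρ-inj eq)

  -- Consequences of a primitive root of unity

  module PrimitiveRoot {n : ℕ} {{n≢0 : NonZero n}} {ζ : Carrier} (ζ-order : HasOrder ζ n) where
    ζⁿ≈1 = proj₁ ζ-order

    ζ≉0 : ζ ≉ 0#
    ζ≉0 = root-of-unity≉0 n ζⁿ≈1

    power-root : ∀ i → (ζ ^ i) ^ n ≈ 1#
    power-root i = trans (^-assocʳ ζ i n) (Mul.multiple-·≈ε ζⁿ≈1 (n∣m*n i))

    powers-injective : Injective _≡_ _≈_ (λ (i : Fin n) → ζ ^ toℕ i)
    powers-injective {i} {j} eq = Fin.toℕ-injective (Mul.multiples-injective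
      (λ i → *-cancelˡ (^-≉0 i ζ≉0)) (Mul.order-minimal ζ-order) (Fin.toℕ<n i) (Fin.toℕ<n j) eq)

    -- An `x` outside the `n` powers of ζ would be one more root of X^n - 1 than its degree allows.
    powers-exhaust : ∀ {x} → x ^ n ≈ 1# → ∃[ i ] x ≈ ζ ^ toℕ {n} i
    powers-exhaust {x} xⁿ≈1 = decidable-stable em λ none → ℕ.1+n≰n
      (roots-of-unity-bound (∷-injective powers-injective λ i eq → none (i , eq)) λ
        { zero → xⁿ≈1 ; (suc i) → power-root (toℕ i) })

    -- The geometric series (x - 1)(1 + ... + x^(k-1)) = x^k - 1, arranged without subtraction.
    eval-ones : ∀ k x → x * eval {k} (λ _ → 1#) x + 1# ≈ eval {k} (λ _ → 1#) x + x ^ k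
    eval-ones zero    x = +-congʳ (zeroʳ x)
    eval-ones (suc k) x = begin
      x * eval {suc k} (λ _ → 1#) x + 1#        ≈⟨ +-congʳ (*-congˡ (horner {k} (λ _ → 1#) x)) ⟩
      x * (1# + x * eval {k} (λ _ → 1#) x) + 1# ≈⟨ solve 2 (λ x E → x :* (con 1 :+ x :* E) :+ con 1 := con 1 :+ x :* (x :* E :+ con 1)) refl x _ ⟩
      1# + x * (x * eval {k} (λ _ → 1#) x + 1#) ≈⟨ +-congˡ (*-congˡ (eval-ones k x)) ⟩
      1# + x * (eval {k} (λ _ → 1#) x + x ^ k)  ≈⟨ solve 3 (λ x E X → con 1 :+ x :* (E :+ X) := con 1 :+ x :* E :+ x :* X) refl x _ _ ⟩
      1# + x * eval {k} (λ _ → 1#) x + x ^ suc k ≈⟨ +-congʳ (horner {k} (λ _ → 1#) x) ⟨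
      eval {suc k} (λ _ → 1#) x + x ^ suc k     ∎

    -- If n were 0 in F, the powers of ζ would be n roots of 1 + X + … + X^(n−1).
    n·1≉0 : n · 1# ≉ 0#
    n·1≉0 n·1≈0 = 1≉0 (vanishing-polynomial {n} (λ _ → 1#) powers-injective eval≈0 (fromℕ< {0} (ℕ.>-nonZero⁻¹ n)))
      where
      eval≈0 : ∀ i → eval {n} (λ _ → 1#) (ζ ^ toℕ i) ≈ 0#
      eval≈0 i with dec (ζ ^ toℕ i ≈ 1#)
      ... | yes ζⁱ≈1 = trans (sum-cong-≋ {n} λ j → trans (*-identityˡ _) (trans (^-congˡ (toℕ j) ζⁱ≈1) (Mul.·-ε (toℕ j))))
                         (trans (sum-replicate n) n·1≈0)
      ... | no  ζⁱ≉1 = *-separates ζⁱ≉1 (trans (∙-cancelʳ 1# _ _ (trans (eval-ones n (ζ ^ toℕ i))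
                         (+-congˡ (power-root (toℕ i))))) (sym (*-identityˡ _)))

    μ-cardinality : HasCardinality (μ n F) n
    μ-cardinality = record
      { to        = λ (_ , _ , xⁿ≈1) → proj₁ (powers-exhaust xⁿ≈1)
      ; from      = λ i → ζ ^ toℕ i , ≉0⇒unit (^-≉0 (toℕ i) ζ≉0) , power-root (toℕ i)
      ; to-cong   = λ {(_ , _ , xⁿ≈1)} {(_ , _ , yⁿ≈1)} x≈y → powers-injective
          (trans (sym (proj₂ (powers-exhaust xⁿ≈1))) (trans x≈y (proj₂ (powers-exhaust yⁿ≈1))))
      ; from-cong = λ { ≡.refl → refl }
      ; inverse   = (λ {_} {(_ , _ , xⁿ≈1)} x≈ζⁱ → powers-injective (trans (sym (proj₂ (powers-exhaust xⁿ≈1))) x≈ζⁱ))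
                  , (λ { {_ , _ , xⁿ≈1} ≡.refl → sym (proj₂ (powers-exhaust xⁿ≈1)) })
      }

  module _ {n : ℕ} (|μₙ|≡n : HasCardinality (μ n F) n) where
    open Inverse |μₙ|≡n

    roots : Vector Carrier n
    roots = proj₁ ∘ from

    roots-injective : Injective _≡_ _≈_ roots
    roots-injective {i} {j} eq = ≡.trans (≡.sym (inverseˡ {i} {from i} refl)) (inverseˡ {j} {from i} eq)

    -- For n = p m, not all `n` roots can satisfy x^m = 1, as there are at most m < n such elements;
    -- `element-of-order` asks for just this.
    exists-primitive-root : .{{NonZero n}} → ∃[ ζ ] HasOrder ζ n
    exists-primitive-root = Mul.element-of-order em n λ {p} m pp n≡pm → decidable-stable em λ none →
      ℕ.<⇒≱ (prime-cofactor-< pp n≡pm)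
        (roots-of-unity-bound {{cofactor-nonZero {q = p} n≡pm}} roots-injective λ i → ≈-stable λ rootᵐ≉1 →
          none (roots i , proj₂ (proj₂ (from i)) , rootᵐ≉1))

-- Iterates of an injective field endomorphism and their periods

module EndomorphismTheory (em : ∀ {a : Level} → ExcludedMiddle a) {u : Level} (L : Field u)
  (σ : FieldNotions.Carrier L → FieldNotions.Carrier L)
  (σ-mono : IsRingMonomorphism (FieldNotions.rawRing L) (FieldNotions.rawRing L) σ) where
  open FieldTheory em L
  open Choice em
  open IsRingMonomorphism σ-mono
    renaming (⟦⟧-cong to σ-cong; +-homo to σ-+; *-homo to σ-*; 0#-homo to σ-0; 1#-homo to σ-1; -‿homo to σ-neg; injective to σ-injective)
  open import Algebra.Properties.Monoid.Sum (CommutativeMonoid.monoid +-commutativeMonoid) using (sum-init-last)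
  open import Algebra.Properties.Group +-group using (x∙y⁻¹≈ε⇒x≈y; ∙-cancelˡ)
  open import Relation.Binary.Reasoning.Setoid setoid

  iter : ℕ → Carrier → Carrier
  iter zero    x = x
  iter (suc j) x = σ (iter j x)

  iter-∘ : ∀ i j x → iter (i ℕ.+ j) x ≡ iter i (iter j x)
  iter-∘ zero    j x = ≡.refl
  iter-∘ (suc i) j x = ≡.cong σ (iter-∘ i j x)

  iter-cong : ∀ j {x y} → x ≈ y → iter j x ≈ iter j y
  iter-cong zero    x≈y = x≈y
  iter-cong (suc j) x≈y = σ-cong (iter-cong j x≈y)

  iter-injective : ∀ j {x y} → iter j x ≈ iter j y → x ≈ y
  iter-injective zero    eq = eq
  iter-injective (suc j) eq = iter-injective j (σ-injective eq)

  iter-+ : ∀ j x y → iter j (x + y) ≈ iter j x + iter j y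
  iter-+ zero    x y = refl
  iter-+ (suc j) x y = trans (σ-cong (iter-+ j x y)) (σ-+ _ _)

  iter-* : ∀ j x y → iter j (x * y) ≈ iter j x * iter j y
  iter-* zero    x y = refl
  iter-* (suc j) x y = trans (σ-cong (iter-* j x y)) (σ-* _ _)

  iter-0 : ∀ j → iter j 0# ≈ 0#
  iter-0 zero    = refl
  iter-0 (suc j) = trans (σ-cong (iter-0 j)) σ-0

  iter-1 : ∀ j → iter j 1# ≈ 1#
  iter-1 zero    = refl
  iter-1 (suc j) = trans (σ-cong (iter-1 j)) σ-1

  iter-sum : ∀ j {k} (f : Vector Carrier k) → iter j (sum f) ≈ sum (iter j ∘ f)
  iter-sum j {zero}  f = iter-0 j
  iter-sum j {suc k} f = trans (iter-+ j _ _) (+-congˡ (iter-sum j (tail f)))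

  iter-^ : ∀ j x n → iter j (x ^ n) ≈ iter j x ^ n
  iter-^ j x zero    = iter-1 j
  iter-^ j x (suc n) = trans (iter-* j x (x ^ n)) (*-congˡ (iter-^ j x n))

  Fixed : Pred Carrier u
  Fixed x = σ x ≈ x

  iter-fixed : ∀ j {x} → Fixed x → iter j x ≈ x
  iter-fixed zero    fx = refl
  iter-fixed (suc j) fx = trans (σ-cong (iter-fixed j fx)) fx

  fixed-* : ∀ {x y} → Fixed x → Fixed y → Fixed (x * y)
  fixed-* fx fy = trans (σ-* _ _) (*-cong fx fy)

  fixed-neg : ∀ {x} → Fixed x → Fixed (- x)
  fixed-neg fx = trans (σ-neg _) (-‿cong fx)

  fixed-inverse : ∀ {x y} → x * y ≈ 1# → Fixed x → Fixed y
  fixed-inverse {x} {y} xy≈1 fx = *-cancelˡ x≉0 (begin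
    x * σ y   ≈⟨ *-congʳ fx ⟨
    σ x * σ y ≈⟨ σ-* x y ⟨
    σ (x * y) ≈⟨ trans (σ-cong xy≈1) σ-1 ⟩
    1#        ≈⟨ xy≈1 ⟨
    x * y     ∎)
    where
    x≉0 : x ≉ 0#
    x≉0 x≈0 = 1≉0 (trans (sym xy≈1) (trans (*-congʳ x≈0) (zeroˡ y)))

  FixesOn : ∀ {ℓ} → Pred Carrier ℓ → ℕ → Set _
  FixesOn E j = ∀ x → x ∈ E → iter j x ≈ x

  fixes-point : ∀ {y} j → iter j y ≈ y → FixesOn (_≡ y) j
  fixes-point j eq _ ≡.refl = eq

  iter-multiple : ∀ {m x} q → iter m x ≈ x → iter (q ℕ.* m) x ≈ x
  iter-multiple {m} {x} zero    eq = refl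
  iter-multiple {m} {x} (suc q) eq = trans (reflexive (iter-∘ m (q ℕ.* m) x)) (trans (iter-cong m (iter-multiple q eq)) eq)

  iter-% : ∀ {m x} .{{_ : NonZero m}} → iter m x ≈ x → ∀ j → iter j x ≈ iter (j % m) x
  iter-% {m} {x} eq j = begin
    iter j x                              ≡⟨ ≡.cong (λ j → iter j x) (m≡m%n+[m/n]*n j m) ⟩
    iter (j % m ℕ.+ (j / m) ℕ.* m) x      ≡⟨ iter-∘ (j % m) _ x ⟩
    iter (j % m) (iter ((j / m) ℕ.* m) x) ≈⟨ iter-cong (j % m) (iter-multiple (j / m) eq) ⟩
    iter (j % m) x                        ∎

  -- Taken relative to a set `E`, this is the order of σ for `U`, the number of conjugates of `y`
  -- for `_≡ y`, and the order of the restriction of σ for an intermediate field.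
  record Period {ℓ} (E : Pred Carrier ℓ) (m : ℕ) : Set (u Level.⊔ ℓ) where
    field
      {{nonZero}} : NonZero m
      fixes       : FixesOn E m
      minimal     : ∀ {j} → 0 < j → j < m → ¬ FixesOn E j

    period-∣ : ∀ {j} → FixesOn E j → m ∣ j
    period-∣ {j} fixes-j with j % m in j%m
    ... | zero  = m%n≡0⇒n∣m j m j%m
    ... | suc r = contradiction
      (λ x x∈E → trans (sym (trans (iter-% {m} (fixes x x∈E) j) (reflexive (≡.cong (λ r → iter r x) j%m)))) (fixes-j x x∈E))
      (minimal (s≤s z≤n) (≡.subst (_< m) j%m (m%n<n j m)))

  period-exists : ∀ {ℓ} (E : Pred Carrier ℓ) {j} → 0 < j → FixesOn E j → ∃[ m ] Period E m
  period-exists E {suc j} _ fixes-j with least (λ j → FixesOn E (suc j)) {j} fixes-j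
  ... | m , fixes-m , min = suc m , record
    { fixes   = fixes-m
    ; minimal = λ { {suc j} _ (s≤s j<m) → min j<m } }

  difference≉0 : ∀ {x y} → x ≉ y → x + - y ≉ 0#
  difference≉0 x≉y eq = x≉y (x∙y⁻¹≈ε⇒x≈y _ _ eq)

  module _ {ℓ} {E : Pred Carrier ℓ} {m : ℕ} (moves : ∀ {j} → 0 < j → j < m → ¬ FixesOn E j) where

    iterates-distinct : ∀ {i j} → i < j → j < m → ¬ (∀ x → x ∈ E → iter i x ≈ iter j x)
    iterates-distinct {i} {j} i<j j<m agree = moves (ℕ.m<n⇒0<n∸m i<j) (ℕ.≤-<-trans (ℕ.m∸n≤m j i) j<m)
      λ x x∈E → iter-injective i (begin
        iter i (iter (j ℕ.∸ i) x) ≡⟨ iter-∘ i (j ℕ.∸ i) x ⟨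
        iter (i ℕ.+ (j ℕ.∸ i)) x  ≡⟨ ≡.cong (λ j → iter j x) (ℕ.m+[n∸m]≡n (ℕ.<⇒≤ i<j)) ⟩
        iter j x                  ≈⟨ agree x x∈E ⟨
        iter i x                  ∎)

    iterates-injective : ∀ {i j} → i < m → j < m → (∀ x → x ∈ E → iter i x ≈ iter j x) → i ≡ j
    iterates-injective {i} {j} i<m j<m agree with ℕ.<-cmp i j
    ... | tri< i<j _ _ = contradiction agree (iterates-distinct i<j j<m)
    ... | tri≈ _ i≡j _ = i≡j
    ... | tri> _ _ j<i = contradiction (λ x x∈E → sym (agree x x∈E)) (iterates-distinct j<i i<m)

  orbit-injective : ∀ {y m} → Period (_≡ y) m → Injective _≡_ _≈_ (λ (i : Fin m) → iter (toℕ i) y)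
  orbit-injective period {i} {j} eq = Fin.toℕ-injective
    (iterates-injective (Period.minimal period) (Fin.toℕ<n i) (Fin.toℕ<n j) λ { _ ≡.refl → eq })

  -- Dedekind's theorem and linear algebra over the fixed field

  module _ {ℓ} (E : Pred Carrier ℓ) (1∈E : 1# ∈ E) (*-closed : ∀ {x y} → x ∈ E → y ∈ E → x * y ∈ E) where

    -- Subtracting `χ zero w` times the relation at x from the relation at w x removes the first
    -- character. By induction `c (suc j)` times `χ (suc j) w + - χ zero w` vanishes, and a `w`
    -- separating the two characters kills `c (suc j)`. Evaluation at 1 settles `c zero`.
    dedekind : ∀ {k} (χ : Fin k → Carrier → Carrier) → (∀ i → χ i 1# ≈ 1#) →
      (∀ i x y → χ i (x * y) ≈ χ i x * χ i y) →
      (∀ {i j} → (∀ x → x ∈ E → χ i x ≈ χ j x) → i ≡ j) →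
      (c : Vector Carrier k) → (∀ {x} → x ∈ E → sum (λ i → c i * χ i x) ≈ 0#) → ∀ i → c i ≈ 0#
    dedekind {suc k} χ χ-1 χ-* χ-inj c rel = λ { zero → c₀≈0 ; (suc i) → cₛ≈0 i }
      where
      cₛ≈0 : ∀ i → c (suc i) ≈ 0#
      cₛ≈0 i = ≈-stable λ cₛ≉0 → contradiction (χ-inj {zero} {suc i} λ w w∈E → ≈-stable λ χ₀w≉χᵢw → cₛ≉0
        (*≈0⇒ (trans (*-comm _ _) (twisted w∈E i)) (difference≉0 (χ₀w≉χᵢw ∘ sym)))) λ ()
        where
        twisted : ∀ {w} → w ∈ E → ∀ j → c (suc j) * (χ (suc j) w + - χ zero w) ≈ 0#
        twisted {w} w∈E = dedekind (χ ∘ suc) (χ-1 ∘ suc) (χ-* ∘ suc) (Fin.suc-injective ∘ χ-inj) _ λ {x} x∈E →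
          let e = - χ zero w
              A = sum (λ j → c (suc j) * χ (suc j) (w * x))
              B = sum (λ j → c (suc j) * χ (suc j) x)
              c₀ = c zero
              X = χ zero x
              W = χ zero w
          in begin
            sum (λ j → c (suc j) * (χ (suc j) w + e) * χ (suc j) x)
              ≈⟨ sum-cong-≋ (λ j → trans
                   (solve 4 (λ c v e y → c :* (v :+ e) :* y := c :* (v :* y) :+ e :* (c :* y)) refl
                     (c (suc j)) (χ (suc j) w) e (χ (suc j) x))
                   (+-congʳ (*-congˡ (sym (χ-* (suc j) w x))))) ⟩
            sum (λ j → c (suc j) * χ (suc j) (w * x) + e * (c (suc j) * χ (suc j) x))
              ≈⟨ ∑-distrib-+ (λ j → c (suc j) * χ (suc j) (w * x)) (λ j → e * (c (suc j) * χ (suc j) x)) ⟩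
            A + sum (λ j → e * (c (suc j) * χ (suc j) x))
              ≈⟨ +-congˡ (*-distribˡ-sum e (λ j → c (suc j) * χ (suc j) x)) ⟨
            A + e * B
              -- The zero term c₀ X (W - W) supplies the summands that complete `A` and `B` to the
              -- full relations at w x and at x.
              ≈⟨ trans (sym (+-identityʳ _)) (+-congˡ (sym (trans (*-congˡ (-‿inverseʳ W)) (zeroʳ (c₀ * X))))) ⟩
            A + e * B + c₀ * X * (W + e)
              ≈⟨ solve 6 (λ A e B c X W → A :+ e :* B :+ c :* X :* (W :+ e) := (c :* (W :* X) :+ A) :+ e :* (c :* X :+ B)) refl A e B c₀ X W ⟩
            (c₀ * (W * X) + A) + e * (c₀ * X + B)
              ≈⟨ +-cong (trans (+-congʳ (*-congˡ (sym (χ-* zero w x)))) (rel (*-closed w∈E x∈E)))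
                        (trans (*-congˡ (rel x∈E)) (zeroʳ e)) ⟩
            0# + 0#
              ≈⟨ +-identityʳ 0# ⟩
            0# ∎
      c₀≈0 : c zero ≈ 0#
      c₀≈0 = begin
        c zero                              ≈⟨ trans (sym (*-identityʳ _)) (*-congˡ (sym (χ-1 zero))) ⟩
        c zero * χ zero 1#                  ≈⟨ trans (sym (+-identityʳ _)) (+-congˡ (sym
          (sum-zero {f = λ i → c (suc i) * χ (suc i) 1#} λ i → trans (*-congʳ (cₛ≈0 i)) (zeroˡ _)))) ⟩
        sum (λ i → c i * χ i 1#)            ≈⟨ rel 1∈E ⟩
        0#                                  ∎

    iterates-independent : ∀ {m} → (∀ {j} → 0 < j → j < m → ¬ FixesOn E j) →
      (c : Vector Carrier m) → (∀ {x} → x ∈ E → sum (λ i → c i * iter (toℕ i) x) ≈ 0#) → ∀ i → c i ≈ 0#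
    iterates-independent {m} moves = dedekind (iter ∘ toℕ) (iter-1 ∘ toℕ) (iter-* ∘ toℕ) λ {i} {j} agree →
      Fin.toℕ-injective (iterates-injective moves (Fin.toℕ<n i) (Fin.toℕ<n j) agree)

  -- The scalars are the elements of `L` fixed by σ, which keeps linear algebra over the base field
  -- inside `L`.
  Combination : ∀ {k} → Vector Carrier k → Pred Carrier u
  Combination {k} b x = Σ (Vector Carrier k) λ c → (∀ i → Fixed (c i)) × x ≈ sum (λ i → c i * b i)

  Independent : ∀ {k} → Vector Carrier k → Set u
  Independent {k} b = (c : Vector Carrier k) → (∀ i → Fixed (c i)) → sum (λ i → c i * b i) ≈ 0# → ∀ i → c i ≈ 0#

  -- The coefficients are extended by zero along `f`, by means of the Kronecker symbol δ.
  independent-∘ : ∀ {m k} {b : Vector Carrier k} → Independent b → {f : Fin m → Fin k} → Injective _≡_ _≡_ f → Independent (b ∘ f)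
  independent-∘ {m} {k} {b} b-ind {f} f-inj c c-fixed Σ≈0 i = trans (sym (extension-f i)) (b-ind extension extension-fixed
    (begin
      sum (λ j → extension j * b j)
        ≈⟨ sum-cong-≋ {k} (λ j → *-distribʳ-sum {m} (b j) (λ i → δ (f i) j * c i)) ⟩
      sum (λ j → sum (λ i → δ (f i) j * c i * b j))
        ≈⟨ ∑-comm {k} {m} (λ j i → δ (f i) j * c i * b j) ⟩
      sum (λ i → sum (λ j → δ (f i) j * c i * b j))
        ≈⟨ sum-cong-≋ {m} (λ i → trans (sum-cong-≋ {k} λ j → *-assoc (δ (f i) j) (c i) (b j)) (sum-δ (f i) (λ j → c i * b j))) ⟩
      sum (λ i → c i * b (f i))
        ≈⟨ Σ≈0 ⟩
      0# ∎) (f i))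
    where
    δ : ∀ {k} → Fin k → Fin k → Carrier
    δ i j with i Fin.≟ j
    ... | yes _ = 1#
    ... | no  _ = 0#
    δ-diagonal : ∀ {k} (i : Fin k) → δ i i ≈ 1#
    δ-diagonal i with i Fin.≟ i
    ... | yes _   = refl
    ... | no  i≢i = contradiction ≡.refl i≢i
    δ-off-diagonal : ∀ {k} {i j : Fin k} → i ≢ j → δ i j ≈ 0#
    δ-off-diagonal {i = i} {j} i≢j with i Fin.≟ j
    ... | yes i≡j = contradiction i≡j i≢j
    ... | no  _   = refl
    δ-fixed : ∀ {k} (i j : Fin k) → Fixed (δ i j)
    δ-fixed i j with i Fin.≟ j
    ... | yes _ = σ-1
    ... | no  _ = σ-0
    sum-δ : ∀ {k} (i : Fin k) (g : Vector Carrier k) → sum (λ j → δ i j * g j) ≈ g i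
    sum-δ {suc k} i g = begin
      sum (λ j → δ i j * g j)
        ≈⟨ sum-remove {i = i} (λ j → δ i j * g j) ⟩
      δ i i * g i + sum (λ j → δ i (punchIn i j) * g (punchIn i j))
        ≈⟨ +-cong (trans (*-congʳ (δ-diagonal i)) (*-identityˡ _))
             (sum-zero {f = λ j → δ i (punchIn i j) * g (punchIn i j)} λ j →
               trans (*-congʳ (δ-off-diagonal (Fin.punchInᵢ≢i i j ∘ ≡.sym))) (zeroˡ _)) ⟩
      g i + 0#
        ≈⟨ +-identityʳ (g i) ⟩
      g i ∎
    extension : Vector Carrier k
    extension j = sum (λ i → δ (f i) j * c i)
    extension-fixed : ∀ j → Fixed (extension j)
    extension-fixed j = trans (iter-sum 1 (λ i → δ (f i) j * c i)) (sum-cong-≋ {m} λ i → fixed-* (δ-fixed (f i) j) (c-fixed i))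
    extension-f : ∀ i → extension (f i) ≈ c i
    extension-f i = trans (sum-cong-≋ {m} λ l → *-congʳ {c l} (δ-f l)) (sum-δ i c)
      where
      δ-f : ∀ l → δ (f l) (f i) ≈ δ i l
      δ-f l with i Fin.≟ l
      ... | yes ≡.refl = δ-diagonal (f i)
      ... | no  i≢l    = δ-off-diagonal (λ fl≡fi → i≢l (≡.sym (f-inj fl≡fi)))

  -- If e < m, the `e` equations Σ cⱼ σ^j(bᵢ) = 0 in `m` unknowns have a nonzero solution. Since σ
  -- fixes the scalars, Σ cⱼ σ^j then vanishes on all of `E`, against Dedekind.
  spanning-bound : ∀ {ℓ} (E : Pred Carrier ℓ) → 1# ∈ E → (∀ {x y} → x ∈ E → y ∈ E → x * y ∈ E) →
    ∀ {e m} {b : Vector Carrier e} → (∀ {x} → x ∈ E → x ∈ Combination b) →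
    (∀ {j} → 0 < j → j < m → ¬ FixesOn E j) → m ≤ e
  spanning-bound E 1∈E *-closed {e} {m} {b} spanning moves with m ℕ.≤? e
  ... | yes m≤e = m≤e
  ... | no  m≰e with homogeneous-system (ℕ.≰⇒> m≰e) (λ i j → iter (toℕ j) (b i))
  ... | c , (j , cⱼ≉0) , eqs = contradiction (iterates-independent E 1∈E *-closed moves c relation j) cⱼ≉0
    where
    relation : ∀ {x} → x ∈ E → sum (λ j → c j * iter (toℕ j) x) ≈ 0#
    relation {x} x∈E with spanning x∈E
    ... | k , k-fixed , x≈Σ = begin
      sum (λ j → c j * iter (toℕ j) x)
        ≈⟨ sum-cong-≋ {m} (λ j → *-congˡ {c j} (trans (iter-cong (toℕ j) x≈Σ) (trans (iter-sum (toℕ j) (λ i → k i * b i))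
             (sum-cong-≋ λ i → trans (iter-* (toℕ j) (k i) (b i)) (*-congʳ (iter-fixed (toℕ j) (k-fixed i))))))) ⟩
      sum (λ j → c j * sum (λ i → k i * iter (toℕ j) (b i)))
        ≈⟨ sum-cong-≋ (λ j → *-distribˡ-sum (c j) (λ i → k i * iter (toℕ j) (b i))) ⟩
      sum (λ j → sum (λ i → c j * (k i * iter (toℕ j) (b i))))
        ≈⟨ ∑-comm (λ j i → c j * (k i * iter (toℕ j) (b i))) ⟩
      sum (λ i → sum (λ j → c j * (k i * iter (toℕ j) (b i))))
        ≈⟨ sum-zero {f = λ i → sum (λ j → c j * (k i * iter (toℕ j) (b i)))} (λ i → trans
             (sum-cong-≋ λ j → trans (x∙yz≈y∙xz (c j) (k i) _) (*-congˡ (*-comm (c j) _)))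
             (trans (sym (*-distribˡ-sum (k i) (λ j → iter (toℕ j) (b i) * c j))) (trans (*-congˡ (eqs i)) (zeroʳ (k i))))) ⟩
      0# ∎

  -- If `x` is no combination, its coefficient in any relation must be 0, as it could be divided
  -- out; the rest is then a relation among `b`.
  dependent⇒combination : ∀ {k x} {b : Vector Carrier k} → Independent b → ¬ Independent (x ∷ᵛ b) → x ∈ Combination b
  dependent⇒combination {k} {x} {b} b-ind ¬ind = decidable-stable em λ not-combination → ¬ind λ c c-fixed rel →
    let c₀≈0 = ≈-stable λ c₀≉0 → not-combination (solve-for-x c c-fixed rel c₀≉0)
    in λ { zero → c₀≈0
         ; (suc i) → b-ind (tail c) (c-fixed ∘ suc) (trans (sym (+-identityˡ _)) (trans (+-congʳ (sym (trans (*-congʳ c₀≈0) (zeroˡ x)))) rel)) i }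
    where
    solve-for-x : ∀ c → (∀ i → Fixed (c i)) → sum (λ i → c i * (x ∷ᵛ b) i) ≈ 0# → c zero ≉ 0# → x ∈ Combination b
    solve-for-x c c-fixed rel c₀≉0 with invert c₀≉0
    ... | d , c₀d≈1 = (λ i → - d * c (suc i)) , (λ i → fixed-* (fixed-neg (fixed-inverse c₀d≈1 (c-fixed zero))) (c-fixed (suc i))) , (begin
      x                              ≈⟨ trans (sym (+-identityʳ x)) (+-congˡ (sym (trans (*-congˡ rel) (zeroʳ (- d))))) ⟩
      x + - d * (c zero * x + S)     ≈⟨ solve 4 (λ x e c S → x :+ e :* (c :* x :+ S) := (con 1 :+ c :* e) :* x :+ e :* S) refl x (- d) (c zero) S ⟩
      (1# + c zero * - d) * x + - d * S ≈⟨ +-congʳ (trans (*-congʳ (trans (+-congˡ (trans (sym (-‿distribʳ-* (c zero) d)) (-‿cong c₀d≈1))) (-‿inverseʳ 1#))) (zeroˡ x)) ⟩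
      0# + - d * S                   ≈⟨ trans (+-identityˡ _) (*-distribˡ-sum (- d) (λ i → c (suc i) * b i)) ⟩
      sum (λ i → - d * (c (suc i) * b i)) ≈⟨ sum-cong-≋ (λ i → sym (*-assoc (- d) (c (suc i)) (b i))) ⟩
      sum (λ i → - d * c (suc i) * b i) ∎)
      where S = sum (λ i → c (suc i) * b i)

  -- After adding f 0 = f n, both sides are the sum of f over 0, ..., n. This gives the behaviour of
  -- traces and resolvents under σ.
  cyclic-shift : ∀ n (f : ℕ → Carrier) → f n ≈ f 0 → sum {n} (λ i → f (suc (toℕ i))) ≈ sum {n} (λ i → f (toℕ i))
  cyclic-shift n f fn≈f0 = ∙-cancelˡ (f 0) _ _ (begin
    sum {suc n} (λ i → f (toℕ i))                             ≈⟨ sum-init-last {n} (λ i → f (toℕ i)) ⟩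
    sum {n} (λ i → f (toℕ (Fin.inject₁ i))) + f (toℕ (Fin.fromℕ n)) ≈⟨ +-cong
      (sum-cong-≋ {n} λ i → reflexive (≡.cong f (Fin.toℕ-inject₁ i))) (trans (reflexive (≡.cong f (Fin.toℕ-fromℕ n))) fn≈f0) ⟩
    sum {n} (λ i → f (toℕ i)) + f 0                           ≈⟨ +-comm _ _ ⟩
    f 0 + sum {n} (λ i → f (toℕ i))                           ∎)

  -- Traces, Artin's theorem and fixed fields for σ of finite order

  module FiniteOrder {N : ℕ} (σ-order : Period U N) where
    open Period σ-order using () renaming (nonZero to N≢0; minimal to σ-minimal)

    iterN : ∀ x → iter N x ≈ x
    iterN x = Period.fixes σ-order x _

    trace : Carrier → Carrier
    trace x = sum {N} (λ j → iter (toℕ j) x)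

    trace-fixed : ∀ x → Fixed (trace x)
    trace-fixed x = trans (iter-sum 1 {N} (λ j → iter (toℕ j) x)) (cyclic-shift N (λ j → iter j x) (iterN _))

    -- A vanishing trace would be a relation among the distinct iterates with all coefficients 1.
    trace≉0 : ∃[ x ] trace x ≉ 0#
    trace≉0 = decidable-stable em λ none → 1≉0 (iterates-independent U _ _ σ-minimal (λ _ → 1#)
      (λ {x} _ → trans (sum-cong-≋ {N} λ j → *-identityˡ (iter (toℕ j) x)) (≈-stable λ tr≉0 → none (x , tr≉0))) (fromℕ< {0} (ℕ.>-nonZero⁻¹ N)))

    -- A nontrivial solution of Σ σ^j(bᵢ) cᵢ = 0 for j < m is one for all j; scaling it and taking traces puts it in K.
    artin : ∀ {k m} .{{_ : NonZero m}} {b : Vector Carrier k} → Independent b → (∀ i → iter m (b i) ≈ b i) → k ≤ m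
    artin {k} {m} {b} b-ind b-fixed with k ℕ.≤? m
    ... | yes k≤m = k≤m
    ... | no  k≰m with homogeneous-system (ℕ.≰⇒> k≰m) (λ j i → iter (toℕ j) (b i)) | trace≉0
    ... | c , (l , cₗ≉0) , eqs | y , tr≉0 with invert cₗ≉0
    ... | d , cₗd≈1 = contradiction (b-ind (λ i → trace (c i * z)) (λ i → trace-fixed _) relation l)
      (λ eq → tr≉0 (trans (sum-cong-≋ {N} λ j → iter-cong (toℕ j) (sym clz≈y)) eq))
      where
      -- This makes the entry at `l` equal to `y`, whose trace is nonzero.
      z = d * y
      clz≈y : c l * z ≈ y
      clz≈y = trans (sym (*-assoc _ _ _)) (trans (*-congʳ cₗd≈1) (*-identityˡ y))
      all-eqs : ∀ j → sum (λ i → iter j (b i) * c i) ≈ 0#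
      all-eqs j = trans (sum-cong-≋ {k} λ i → *-congʳ (trans (iter-% (b-fixed i) j)
        (reflexive (≡.cong (λ r → iter r (b i)) (≡.sym (Fin.toℕ-fromℕ< (m%n<n j m))))))) (eqs (fromℕ< (m%n<n j m)))
      relation : sum (λ i → trace (c i * z) * b i) ≈ 0#
      relation = begin
        sum (λ i → trace (c i * z) * b i)
          ≈⟨ sum-cong-≋ {k} (λ i → *-distribʳ-sum {N} (b i) (λ j → iter (toℕ j) (c i * z))) ⟩
        sum (λ i → sum {N} (λ j → iter (toℕ j) (c i * z) * b i))
          ≈⟨ ∑-comm {k} {N} (λ i j → iter (toℕ j) (c i * z) * b i) ⟩
        sum {N} (λ j → sum (λ i → iter (toℕ j) (c i * z) * b i))
          ≈⟨ sum-zero {N} {f = λ j → sum (λ i → iter (toℕ j) (c i * z) * b i)} vanish ⟩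
        0# ∎
        where
        vanish : ∀ j → sum (λ i → iter (toℕ {N} j) (c i * z) * b i) ≈ 0#
        vanish j = begin
          sum (λ i → iter j′ (c i * z) * b i)
            -- As σ^N is the identity, bᵢ = σ^j(σ^(N-j) bᵢ). So σ^j comes out of the sum and leaves
            -- the equation for N - j.
            ≈⟨ sum-cong-≋ {k} (λ i → trans (*-congˡ (trans (sym (iterN _))
                 (reflexive (≡.trans (≡.cong (λ r → iter r (b i)) (≡.sym (ℕ.m+[n∸m]≡n (ℕ.<⇒≤ (Fin.toℕ<n j))))) (iter-∘ j′ (N ℕ.∸ j′) (b i))))))
                 (sym (iter-* j′ (c i * z) (iter (N ℕ.∸ j′) (b i))))) ⟩
          sum (λ i → iter j′ (c i * z * iter (N ℕ.∸ j′) (b i)))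
            ≈⟨ iter-sum j′ {k} (λ i → c i * z * iter (N ℕ.∸ j′) (b i)) ⟨
          iter j′ (sum (λ i → c i * z * iter (N ℕ.∸ j′) (b i)))
            ≈⟨ iter-cong j′ (trans (sum-cong-≋ {k} λ i → trans (*-comm _ _) (sym (*-assoc _ (c i) z)))
                 (trans (sym (*-distribʳ-sum {k} z (λ i → iter (N ℕ.∸ j′) (b i) * c i))) (trans (*-congʳ (all-eqs (N ℕ.∸ j′))) (zeroˡ z)))) ⟩
          iter j′ 0#
            ≈⟨ iter-0 j′ ⟩
          0# ∎
          where j′ = toℕ j

    -- Otherwise `x` would extend `b` to `suc m` independent elements fixed by σ^m.
    artin-spanning : ∀ {m} .{{_ : NonZero m}} {b : Vector Carrier m} → Independent b → (∀ i → iter m (b i) ≈ b i) →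
                     ∀ {x} → iter m x ≈ x → x ∈ Combination b
    artin-spanning {b = b} b-ind b-fixed {x} x-fixed = dependent⇒combination b-ind λ ind →
      ℕ.1+n≰n (artin {b = x ∷ᵛ b} ind λ { zero → x-fixed ; (suc i) → b-fixed i })

    module _ {ℓ} (E : Pred Carrier ℓ) (resp : ∀ {x y} → x ≈ y → x ∈ E → y ∈ E) (fixed⊆E : ∀ {x} → Fixed x → x ∈ E)
      (+-closed : ∀ {x y} → x ∈ E → y ∈ E → x + y ∈ E) (*-closed : ∀ {x y} → x ∈ E → y ∈ E → x * y ∈ E) where

      sum∈ : ∀ {k} {f : Vector Carrier k} → (∀ i → f i ∈ E) → sum f ∈ E
      sum∈ {zero}  f∈E = fixed⊆E σ-0
      sum∈ {suc k} f∈E = +-closed (f∈E zero) (sum∈ (f∈E ∘ suc))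

      -- Artin bounds independent families by `N`, so there is one in `E` that cannot be prolonged;
      -- such a family spans.
      independent-spanning-family : ∃[ e ] Σ (Vector Carrier e) λ b →
        (∀ i → b i ∈ E) × Independent b × (∀ {x} → x ∈ E → x ∈ Combination b)
      independent-spanning-family with last-before-failure (λ k → Σ (Vector Carrier k) λ b → (∀ i → b i ∈ E) × Independent b)
        ([]ᵛ , (λ ()) , λ _ _ _ ()) (λ (b , _ , b-ind) → artin b-ind λ i → iterN _)
      ... | e , (b , b∈E , b-ind) , stop = e , b , b∈E , b-ind , λ {x} x∈E → dependent⇒combination b-ind λ ind →
        stop (x ∷ᵛ b , (λ { zero → x∈E ; (suc i) → b∈E i }) , ind)

      -- A basis of E has at least m elements by Dedekind, so by Artin it spans the fixed field of σ^m.
      fixed-by-period⇒∈ : ∀ {m} → Period E m → ∀ {x} → iter m x ≈ x → x ∈ E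
      fixed-by-period⇒∈ {m} period x-fixed with independent-spanning-family
      ... | e , b , b∈E , b-ind , b-span
        with ℕ.≤-antisym (artin {{Period.nonZero period}} b-ind (λ i → Period.fixes period (b i) (b∈E i)))
                         (spanning-bound E (fixed⊆E σ-1) *-closed b-span (Period.minimal period))
      ... | ≡.refl with artin-spanning {{Period.nonZero period}} b-ind (λ i → Period.fixes period (b i) (b∈E i)) x-fixed
      ... | c , c-fixed , x≈Σ = resp (sym x≈Σ) (sum∈ {f = λ i → c i * b i} λ i → *-closed (fixed⊆E (c-fixed i)) (b∈E i))

  -- With `n` spanning elements, Dedekind forbids n + 1 distinct iterates, so some positive j ≤ n
  -- gives the identity and N ≤ n. Artin, applied to the independent `b`, gives n ≤ N.
  order-of-σ : ∀ {n} {b : Vector Carrier n} → (∀ x → x ∈ Combination b) → Independent b → Period U n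
  order-of-σ {n} {b} spanning b-ind with recurrence
    where
    recurrence : ∃[ j ] 0 < j × j < suc n × FixesOn U j
    recurrence = decidable-stable em λ none → ℕ.1+n≰n (spanning-bound U _ _ (λ {x} _ → spanning x)
      (λ 0<j j<1+n fixes → none (_ , 0<j , j<1+n , fixes)))
  ... | j , 0<j , s≤s j≤n , fixes with period-exists U 0<j fixes
  ... | N , period = ≡.subst (Period U) (ℕ.≤-antisym N≤n n≤N) period
    where
    N≤n : N ≤ n
    N≤n = ℕ.≤-trans (∣⇒≤ {{ℕ.>-nonZero 0<j}} (Period.period-∣ period fixes)) j≤n
    n≤N : n ≤ N
    n≤N = FiniteOrder.artin period {{Period.nonZero period}} b-ind λ i → Period.fixes period (b i) _

-- Finite cyclic extensions and the Galois action on roots of unity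

module CyclicExtensions (em : ∀ {a : Level} → ExcludedMiddle a) {u : Level} {K L : Field u}
  (L|K : Extension K L) {n : ℕ} (cyclic : IsFiniteCyclic L|K n) where
  module K = FieldTheory em K
  open FieldTheory em L public
  open ExtensionNotions L|K using (Base; module HasDegree; module Automorphism; Gal; IntermediateField; module IntermediateField)
  open IsFiniteCyclic cyclic using (degree; isGalois; isCyclic)
  open HasDegree degree
  open Extension L|K
  open Arithmetic
  open IsRingHomomorphism isRingHomomorphism
    renaming (⟦⟧-cong to ι-cong; +-homo to ι-+; *-homo to ι-*; 0#-homo to ι-0; 1#-homo to ι-1; -‿homo to ι-neg)
  open import Relation.Binary.Reasoning.Setoid setoid
  open import Algebra.Properties.Group K.+-group using (x∙y⁻¹≈ε⇒x≈y)

  private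
    module σ = Automorphism (proj₁ isCyclic)

  open EndomorphismTheory em L σ.σ σ.isRingMonomorphism public

  ι-≉0 : ∀ {k} → k K.≉ K.0# → ι k ≉ 0#
  ι-≉0 {k} k≉0 ιk≈0 with K.invert k≉0
  ... | k⁻¹ , kk⁻¹≈1 = 1≉0 (begin
    1#             ≈⟨ ι-1 ⟨
    ι K.1#         ≈⟨ ι-cong kk⁻¹≈1 ⟨
    ι (k K.* k⁻¹)  ≈⟨ ι-* k k⁻¹ ⟩
    ι k * ι k⁻¹    ≈⟨ *-congʳ ιk≈0 ⟩
    0# * ι k⁻¹     ≈⟨ zeroˡ _ ⟩
    0#             ∎)

  ι-injective : ∀ {k l} → ι k ≈ ι l → k K.≈ l
  ι-injective {k} {l} ιk≈ιl = x∙y⁻¹≈ε⇒x≈y k l (K.≈-stable λ k-l≉0 → ι-≉0 k-l≉0 (begin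
    ι (k K.+ K.- l)  ≈⟨ ι-+ k (K.- l) ⟩
    ι k + ι (K.- l)  ≈⟨ +-cong ιk≈ιl (ι-neg l) ⟩
    ι l + - ι l      ≈⟨ -‿inverseʳ (ι l) ⟩
    0#               ∎))

  ι-^ : ∀ k j → ι (k K.^ j) ≈ ι k ^ j
  ι-^ k zero    = ι-1
  ι-^ k (suc j) = trans (ι-* k _) (*-congˡ (ι-^ k j))

  ι-· : ∀ j → ι (j K.· K.1#) ≈ j · 1#
  ι-· zero    = ι-0
  ι-· (suc j) = trans (ι-+ _ _) (+-cong ι-1 (ι-· j))

  ι-fixed : ∀ k → Fixed (ι k)
  ι-fixed = σ.fixes

  base⇒fixed : ∀ {x} → x ∈ Base → Fixed x
  base⇒fixed (k , x≈ιk) = trans (σ.⟦⟧-cong x≈ιk) (trans (ι-fixed k) (sym x≈ιk))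

  -- Every automorphism is a power of σ, possibly negative, so what σ fixes is fixed by the whole
  -- group.
  fixed⇒base : ∀ {x} → Fixed x → x ∈ Base
  fixed⇒base {x} fx = isGalois x λ f → trans (proj₂ (proj₂ isCyclic f) x) (power-fixes (proj₁ (proj₂ isCyclic f)))
    where
    times-fixes : ∀ k → Automorphism.σ (times (Group.rawMonoid Gal) k (proj₁ isCyclic)) x ≈ x
    times-fixes zero    = refl
    times-fixes (suc k) = trans (σ.⟦⟧-cong (times-fixes k)) fx
    power-fixes : ∀ k → Automorphism.σ (power Gal (proj₁ isCyclic) k) x ≈ x
    power-fixes (+ k)    = times-fixes k
    power-fixes -[1+ k ] = Automorphism.σ⁻¹-unique (times (Group.rawMonoid Gal) (suc k) (proj₁ isCyclic)) (times-fixes (suc k))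

  abstract
    -- The given basis over `K` is also one over the fixed field of σ, because the two fields agree.
    σ-order : Period U n
    σ-order = order-of-σ {b = basis} spans linearly-independent
      where
      spans : ∀ x → x ∈ Combination basis
      spans x with spanning x
      ... | c , x≈Σ = ι ∘ c , ι-fixed ∘ c , x≈Σ
      linearly-independent : Independent basis
      linearly-independent c c-fixed Σ≈0 i = trans (c≈ιk i) (trans (ι-cong (independent k
        (trans (sum-cong-≋ {n} λ i → *-congʳ (sym (c≈ιk i))) Σ≈0) i)) ι-0)
        where
        k : Vector K.Carrier n
        k i = proj₁ (fixed⇒base (c-fixed i))
        c≈ιk : ∀ i → c i ≈ ι (k i)
        c≈ιk i = proj₂ (fixed⇒base (c-fixed i))

  open FiniteOrder σ-order public

  instance
    n≢0 : NonZero n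
    n≢0 = Period.nonZero σ-order

  module RootAction {ζ : Carrier} (ζ-order : HasOrder ζ n) where
    open PrimitiveRoot ζ-order public

    abstract
      -- The quotient σζ / ζ is again an n-th root of unity, hence a power of ζ.
      action : ∃[ s ] σ.σ ζ ≈ ζ * ζ ^ s
      action with invert ζ≉0
      ... | ζ⁻¹ , ζζ⁻¹≈1 with powers-exhaust (begin
          (σ.σ ζ * ζ⁻¹) ^ n       ≈⟨ ^-distrib-* _ _ n ⟩
          σ.σ ζ ^ n * ζ⁻¹ ^ n     ≈⟨ *-congʳ (trans (sym (iter-^ 1 ζ n)) (trans (σ.⟦⟧-cong ζⁿ≈1) (trans σ.1#-homo (sym ζⁿ≈1)))) ⟩
          ζ ^ n * ζ⁻¹ ^ n         ≈⟨ ^-distrib-* _ _ n ⟨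
          (ζ * ζ⁻¹) ^ n           ≈⟨ trans (^-congˡ n ζζ⁻¹≈1) (Mul.·-ε n) ⟩
          1#                      ∎)
      ... | i , eq = toℕ i , (begin
          σ.σ ζ                   ≈⟨ trans (sym (*-identityˡ _)) (*-congʳ (sym ζζ⁻¹≈1)) ⟩
          ζ * ζ⁻¹ * σ.σ ζ         ≈⟨ trans (*-assoc _ _ _) (*-congˡ (trans (*-comm _ _) eq)) ⟩
          ζ * ζ ^ toℕ i           ∎)

    s : ℕ
    s = proj₁ action

    σ-power : ∀ j → σ.σ (ζ ^ j) ≈ ζ ^ j * ζ ^ (j ℕ.* s)
    σ-power j = begin
      σ.σ (ζ ^ j)             ≈⟨ iter-^ 1 ζ j ⟩
      σ.σ ζ ^ j               ≈⟨ ^-congˡ j (proj₂ action) ⟩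
      (ζ * ζ ^ s) ^ j         ≈⟨ ^-distrib-* _ _ j ⟩
      ζ ^ j * (ζ ^ s) ^ j     ≈⟨ *-congˡ (trans (^-assocʳ ζ s j) (reflexive (≡.cong (ζ ^_) (ℕ.*-comm s j)))) ⟩
      ζ ^ j * ζ ^ (j ℕ.* s)   ∎

    -- σ multiplies ζ^m by ζ^(m s), which is 1 when n = q m divides m s, that is, when q ∣ s. The
    -- converse follows likewise.
    ∣s⇒fixed : ∀ q m → n ≡ q ℕ.* m → q ∣ s → Fixed (ζ ^ m)
    ∣s⇒fixed q m n≡qm q∣s = trans (σ-power m) (trans (*-congˡ (Mul.multiple-·≈ε ζⁿ≈1
      (≡.subst₂ _∣_ (≡.trans (ℕ.*-comm m q) (≡.sym n≡qm)) ≡.refl (*-monoʳ-∣ m q∣s)))) (*-identityʳ _))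

    fixed⇒∣s : ∀ q m → n ≡ q ℕ.* m → Fixed (ζ ^ m) → q ∣ s
    fixed⇒∣s q m n≡qm fixed = *-cancelˡ-∣ m {{cofactor-nonZero {q = q} n≡qm}} (≡.subst₂ _∣_ (≡.trans n≡qm (ℕ.*-comm q m)) ≡.refl
      (proj₂ ζ-order (m ℕ.* s) (*-cancelˡ (^-≉0 m ζ≉0) (trans (sym (σ-power m)) (trans fixed (sym (*-identityʳ _)))))))

-- From a unitary grading to roots of unity and the co-Galois property

module GradedCyclicExtensions (em : ∀ {a : Level} → ExcludedMiddle a) {u : Level} {K L : Field u}
  (L|K : Extension K L) {n : ℕ} (cyclic : IsFiniteCyclic L|K n) {D : AbelianGroup u u} (𝓛 : UnitaryGrading L|K D) where
  open CyclicExtensions em L|K cyclic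
  open UnitaryGrading 𝓛 renaming (resp to component-resp; spanning to components-span; independent to components-independent)
  open ExtensionNotions L|K using (Base; IntermediateField; module IntermediateField)
  open Extension L|K using (ι)
  open IsRingHomomorphism (Extension.isRingHomomorphism L|K)
    renaming (⟦⟧-cong to ι-cong; 0#-homo to ι-0; 1#-homo to ι-1)
  open Arithmetic
  open import Algebra.Properties.Ring ring using (-1*x≈-x)
  open import Relation.Binary.Reasoning.Setoid setoid
  private
    module D = AbelianGroup D
  module Deg = Orders D.commutativeMonoid
  open import Algebra.Properties.CommutativeMonoid.Mult D.commutativeMonoid using () renaming (_×_ to _·ᴰ_; ×-assocˡ to ·ᴰ-assoc; ×-homo-1 to 1·ᴰ)
  open D using () renaming (_≈_ to _≈ᴰ_; _∙_ to _∙ᴰ_; ε to εᴰ; _⁻¹ to _⁻¹ᴰ)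

  scale : ∀ {d c x} → Fixed c → x ∈ component d → c * x ∈ component d
  scale c-fixed x∈d with fixed⇒base c-fixed
  ... | k , c≈ιk = component-resp D.refl (*-congʳ (sym c≈ιk)) (·-closed k x∈d)

  -- If `d` and `e` differed, `x` and -x would be homogeneous of distinct degrees with sum 0.
  component-unique : ∀ {d e x} → x ∈ component d → x ∈ component e → x ≉ 0# → d ≈ᴰ e
  component-unique {d} {e} {x} x∈d x∈e x≉0 = decidable-stable em λ d≉e → x≉0
    (components-independent (d ∷ᵛ e ∷ᵛ []ᵛ) (x ∷ᵛ - 1# * x ∷ᵛ []ᵛ)
      (λ { {zero} {zero} _ → ≡.refl ; {suc zero} {suc zero} _ → ≡.refl
         ; {zero} {suc zero} d≈e → contradiction d≈e d≉e
         ; {suc zero} {zero} e≈d → contradiction (D.sym e≈d) d≉e })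
      (λ { zero → x∈d ; (suc zero) → scale (fixed-neg (iter-1 1)) x∈e })
      (trans (+-congˡ (trans (+-identityʳ _) (-1*x≈-x x))) (-‿inverseʳ x)) zero)

  fixed⇒∈0 : ∀ {x} → Fixed x → x ∈ component εᴰ
  fixed⇒∈0 fx = proj₂ component-0 (fixed⇒base fx)

  ∈0⇒fixed : ∀ {x} → x ∈ component εᴰ → Fixed x
  ∈0⇒fixed x∈0 = base⇒fixed (proj₁ component-0 x∈0)

  power-∈ : ∀ {d x} j → x ∈ component d → x ^ j ∈ component (j ·ᴰ d)
  power-∈ zero    x∈d = fixed⇒∈0 (iter-1 1)
  power-∈ (suc j) x∈d = *-graded x∈d (power-∈ j x∈d)

  power-fixed⇒ : ∀ {d x} → x ∈ component d → x ≉ 0# → ∀ j → Fixed (x ^ j) → j ·ᴰ d ≈ᴰ εᴰ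
  power-fixed⇒ x∈d x≉0 j fixed = component-unique (power-∈ j x∈d) (fixed⇒∈0 fixed) (^-≉0 j x≉0)

  ⇒power-fixed : ∀ {d x} → x ∈ component d → ∀ j → j ·ᴰ d ≈ᴰ εᴰ → Fixed (x ^ j)
  ⇒power-fixed x∈d j jd≈ε = ∈0⇒fixed (component-resp jd≈ε refl (power-∈ j x∈d))

  homogeneous-independent : ∀ {k} {d : Vector D.Carrier k} {y : Vector Carrier k} → Injective _≡_ _≈ᴰ_ d →
    (∀ i → y i ∈ component (d i)) → (∀ i → y i ≉ 0#) → Independent y
  homogeneous-independent {d = d} {y} d-inj y∈ y≉0 c c-fixed Σ≈0 i = *≈0⇒ (trans (*-comm _ _)
    (components-independent d (λ i → c i * y i) d-inj (λ i → scale (c-fixed i) (y∈ i)) Σ≈0 i)) (y≉0 i)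

  degree-cancel : ∀ d i {e f} → i ·ᴰ d ∙ᴰ e ≈ᴰ i ·ᴰ d ∙ᴰ f → e ≈ᴰ f
  degree-cancel d i {e} {f} = ∙-cancelˡ (i ·ᴰ d) e f
    where open import Algebra.Properties.Group D.group using (∙-cancelˡ)

  powers-independent : ∀ {d x m} → x ∈ component d → x ≉ 0# → (∀ {j} → 0 < j → j < m → ¬ j ·ᴰ d ≈ᴰ εᴰ) →
    Independent {m} (λ i → x ^ toℕ i)
  powers-independent {d} x∈d x≉0 minimal = homogeneous-independent {d = λ i → toℕ i ·ᴰ d}
    (λ {i} {j} eq → Fin.toℕ-injective (Deg.multiples-injective (degree-cancel d) minimal (Fin.toℕ<n i) (Fin.toℕ<n j) eq))
    (λ i → power-∈ (toℕ i) x∈d) (λ i → ^-≉0 (toℕ i) x≉0)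

  -- Conjugates of a homogeneous element and the order of its degree

  module Homogeneous {d : D.Carrier} {y : Carrier} (y∈d : y ∈ component d) (y≉0 : y ≉ 0#) where

    abstract
      period : ∃[ m ] Period (_≡ y) m
      period = period-exists (_≡ y) (ℕ.>-nonZero⁻¹ n) λ x _ → iterN x

    m : ℕ
    m = proj₁ period

    private
      module P = Period (proj₂ period)

    instance
      m≢0 : NonZero m
      m≢0 = P.nonZero

    fixed-by-m : iter m y ≈ y
    fixed-by-m = P.fixes y ≡.refl

    -- The conjugates of y differ by distinct o-th roots of unity.
    period≤ : ∀ o → .{{NonZero o}} → o ·ᴰ d ≈ᴰ εᴰ → m ≤ o
    period≤ o od≈ε with invert y≉0
    ... | z , yz≈1 = roots-of-unity-bound {ρ = λ (i : Fin m) → iter (toℕ i) y * z}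
      (λ eq → orbit-injective (proj₂ period) (*-cancelʳ z≉0 eq))
      (λ i → begin
        (iter (toℕ i) y * z) ^ o     ≈⟨ ^-distrib-* _ z o ⟩
        iter (toℕ i) y ^ o * z ^ o   ≈⟨ *-congʳ (trans (sym (iter-^ (toℕ i) y o)) (iter-fixed (toℕ i) (⇒power-fixed y∈d o od≈ε))) ⟩
        y ^ o * z ^ o                ≈⟨ ^-distrib-* y z o ⟨
        (y * z) ^ o                  ≈⟨ trans (^-congˡ o yz≈1) (Mul.·-ε o) ⟩
        1#                           ∎)
      where
      z≉0 : z ≉ 0#
      z≉0 z≈0 = 1≉0 (trans (sym yz≈1) (trans (*-congˡ z≈0) (zeroʳ y)))

    -- Otherwise the first m + 1 powers of `y` would have distinct degrees and be independent,
    -- although all are fixed by σ^m, against Artin.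
    recurrence : ∃[ j ] 0 < j × j < suc m × j ·ᴰ d ≈ᴰ εᴰ
    recurrence = decidable-stable em λ none → ℕ.1+n≰n (artin
      (powers-independent {m = suc m} y∈d y≉0 λ 0<j j<1+m jd≈ε → none (_ , 0<j , j<1+m , jd≈ε))
      λ i → trans (iter-^ m y (toℕ i)) (^-congˡ (toℕ i) fixed-by-m))

    -- The j ≤ m of the recurrence is `m` by `period≤`. If `k` annihilates `d`, so does gcd m k, and
    -- `period≤` makes this at least `m`.
    degree-order : Deg.HasOrder d m
    degree-order with recurrence
    ... | j , 0<j , s≤s j≤m , jd≈ε = md≈ε , λ k kd≈ε → order∣ k kd≈ε
      where
      md≈ε : m ·ᴰ d ≈ᴰ εᴰ
      md≈ε = ≡.subst (λ m → m ·ᴰ d ≈ᴰ εᴰ) (ℕ.≤-antisym j≤m (period≤ j {{ℕ.>-nonZero 0<j}} jd≈ε)) jd≈ε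
      order∣ : ∀ k → k ·ᴰ d ≈ᴰ εᴰ → m ∣ k
      order∣ k kd≈ε = ≡.subst (_∣ k) gcd≡m (gcd[m,n]∣n m k)
        where
        gcd≢0 : NonZero (gcd m k)
        gcd≢0 = ℕ.≢-nonZero λ eq → ℕ.≢-nonZero⁻¹ m (gcd[m,n]≡0⇒m≡0 eq)
        gcd≡m : gcd m k ≡ m
        gcd≡m = ℕ.≤-antisym (∣⇒≤ (gcd[m,n]∣m m k)) (period≤ (gcd m k) {{gcd≢0}} (Deg.gcd-·≈ε (gcd-GCD m k) md≈ε kd≈ε))

    multiple≈ε⇒fixed : ∀ j → j ·ᴰ d ≈ᴰ εᴰ → iter j y ≈ y
    multiple≈ε⇒fixed j jd≈ε with proj₂ degree-order j jd≈ε
    ... | divides q ≡.refl = iter-multiple q fixed-by-m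

    fixed⇒multiple≈ε : ∀ j → iter j y ≈ y → j ·ᴰ d ≈ᴰ εᴰ
    fixed⇒multiple≈ε j eq = Deg.multiple-·≈ε {m} {j} (proj₁ degree-order) (P.period-∣ (fixes-point j eq))

    n·d≈ε : n ·ᴰ d ≈ᴰ εᴰ
    n·d≈ε = fixed⇒multiple≈ε n (iterN y)

  n·≈ε : ∀ d → n ·ᴰ d ≈ᴰ εᴰ
  n·≈ε d with has-unit d
  ... | y , y∈d , y-unit = Homogeneous.n·d≈ε y∈d (unit⇒≉0 y-unit)

  abstract
    -- If some m = n / p annihilated every degree, σ^m would fix all homogeneous elements and thus
    -- `L`, although σ has order `n`.
    degree-of-order-n : ∃[ d ] Deg.HasOrder d n
    degree-of-order-n = Deg.element-of-order em n λ {p} m pp n≡pm → decidable-stable em λ none →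
      Period.minimal σ-order (ℕ.>-nonZero⁻¹ m {{cofactor-nonZero {q = p} n≡pm}}) (prime-cofactor-< pp n≡pm)
        (λ x _ → fixes-all m (λ d → decidable-stable em λ md≉ε → none (d , n·≈ε d , md≉ε)) x)
      where
      fixes-all : ∀ m → (∀ d → m ·ᴰ d ≈ᴰ εᴰ) → ∀ x → iter m x ≈ x
      fixes-all m md≈ε x with components-span x
      ... | k , d , y , _ , y∈ , x≈Σ = trans (iter-cong m x≈Σ) (trans (iter-sum m y) (trans (sum-cong-≋ {k} fixes) (sym x≈Σ)))
        where
        fixes : ∀ i → iter m (y i) ≈ y i
        fixes i with dec (y i ≈ 0#)
        ... | yes y≈0 = trans (iter-cong m y≈0) (trans (iter-0 m) (sym y≈0))
        ... | no  y≉0 = Homogeneous.multiple≈ε⇒fixed (y∈ i) y≉0 m (md≈ε (d i))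

  d₀ : D.Carrier
  d₀ = proj₁ degree-of-order-n

  d₀-order : Deg.HasOrder d₀ n
  d₀-order = proj₂ degree-of-order-n

  abstract
    x₀ : Carrier
    x₀ = proj₁ (has-unit d₀)

    x₀∈ : x₀ ∈ component d₀
    x₀∈ = proj₁ (proj₂ (has-unit d₀))

    x₀≉0 : x₀ ≉ 0#
    x₀≉0 = unit⇒≉0 (proj₂ (proj₂ (has-unit d₀)))

    Kummer-root : ∃[ ζ ] iter 1 x₀ ≈ ζ * x₀
    Kummer-root = let z , xz≈1 = invert x₀≉0 in iter 1 x₀ * z , (begin
      iter 1 x₀            ≈⟨ *-identityʳ _ ⟨
      iter 1 x₀ * 1#       ≈⟨ *-congˡ (trans (*-comm z x₀) xz≈1) ⟨
      iter 1 x₀ * (z * x₀) ≈⟨ *-assoc _ z x₀ ⟨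
      iter 1 x₀ * z * x₀   ∎)

  ζ : Carrier
  ζ = proj₁ Kummer-root

  σ-x₀^ : ∀ j → iter 1 (x₀ ^ j) ≈ ζ ^ j * x₀ ^ j
  σ-x₀^ j = trans (iter-^ 1 x₀ j) (trans (^-congˡ j (proj₂ Kummer-root)) (^-distrib-* ζ x₀ j))

  -- ζ^j = 1 holds exactly when σ fixes `x₀ ^ j`, that is, when `j` annihilates the degree `d₀`.
  ζ-order : HasOrder ζ n
  ζ-order = *-cancelʳ (^-≉0 n x₀≉0) (trans (sym (σ-x₀^ n)) (trans (⇒power-fixed x₀∈ n (proj₁ d₀-order)) (sym (*-identityˡ _))))
          , λ j ζʲ≈1 → proj₂ d₀-order j (power-fixed⇒ x₀∈ x₀≉0 j
              (trans (σ-x₀^ j) (trans (*-congʳ ζʲ≈1) (*-identityˡ _))))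

  open RootAction ζ-order

  x₀^-fixed⇒∣ : ∀ m j → iter j (x₀ ^ m) ≈ x₀ ^ m → n ∣ j ℕ.* m
  x₀^-fixed⇒∣ m j eq = proj₂ d₀-order (j ℕ.* m) (D.trans (D.sym (·ᴰ-assoc d₀ j m))
    (Homogeneous.fixed⇒multiple≈ε (power-∈ m x₀∈) (^-≉0 m x₀≉0) j eq))

  x₀^-fixed : ∀ m j → n ∣ j ℕ.* m → iter j (x₀ ^ m) ≈ x₀ ^ m
  x₀^-fixed m j n∣jm = Homogeneous.multiple≈ε⇒fixed (power-∈ m x₀∈) (^-≉0 m x₀≉0) j
    (D.trans (·ᴰ-assoc d₀ j m) (Deg.multiple-·≈ε (proj₁ d₀-order) n∣jm))

  n∤multiple : ∀ {q r m} → .{{NonZero r}} → n ≡ q ℕ.* m → r < q → n ∤ r ℕ.* m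
  n∤multiple {q} {r} {m} n≡qm r<q n∣rm = ℕ.<⇒≱ r<q (∣⇒≤ (*-cancelʳ-∣ m {{cofactor-nonZero {q = q} n≡qm}}
    (≡.subst (_∣ r ℕ.* m) n≡qm n∣rm)))

  -- The p-th roots of unity 1, ω, σω, … would be p + 1 in number if σω ≠ ω.
  prime-root-fixed : ∀ {p m} → Prime p → n ≡ p ℕ.* m → Fixed (ζ ^ m)
  prime-root-fixed {p} {m} pp n≡pm = by-period (period-exists (_≡ ω) (ℕ.>-nonZero⁻¹ p) (fixes-point p iter-p-ω))
    where
    instance
      p≢0 : NonZero p
      p≢0 = prime⇒nonZero pp
    ω = ζ ^ m
    y = x₀ ^ m
    iter-p-y : iter p y ≈ y
    iter-p-y = x₀^-fixed m p (∣-reflexive n≡pm)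
    -- σ^p fixes `y` and therefore σ(y) = ω y, so it fixes their quotient ω.
    iter-p-ω : iter p ω ≈ ω
    iter-p-ω = *-cancelʳ (^-≉0 m x₀≉0) (begin
      iter p ω * y         ≈⟨ *-congˡ iter-p-y ⟨
      iter p ω * iter p y  ≈⟨ iter-* p ω y ⟨
      iter p (ω * y)       ≈⟨ iter-cong p (σ-x₀^ m) ⟨
      iter p (iter 1 y)    ≡⟨ iter-∘ p 1 y ⟨
      iter (p ℕ.+ 1) y     ≡⟨ ≡.cong (λ j → iter j y) (ℕ.+-comm p 1) ⟩
      iter 1 (iter p y)    ≈⟨ iter-cong 1 iter-p-y ⟩
      iter 1 y             ≈⟨ σ-x₀^ m ⟩
      ω * y                ∎)
    ωᵖ≈1 : ω ^ p ≈ 1#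
    ωᵖ≈1 = trans (^-assocʳ ζ m p) (Mul.multiple-·≈ε ζⁿ≈1 (∣-reflexive (≡.trans n≡pm (ℕ.*-comm p m))))
    ω≉1 : ω ≉ 1#
    ω≉1 ω≈1 = n∤multiple {p} {1} {m} n≡pm (ℕ.nonTrivial⇒n>1 p {{prime⇒nonTrivial pp}})
      (≡.subst (n ∣_) (≡.sym (ℕ.*-identityˡ m)) (proj₂ ζ-order m ω≈1))
    by-period : ∃[ m′ ] Period (_≡ ω) m′ → Fixed ω
    by-period (m′ , period) with prime⇒irreducible pp (Period.period-∣ period (fixes-point p iter-p-ω))
    ... | inj₁ ≡.refl = Period.fixes period ω ≡.refl
    ... | inj₂ ≡.refl = contradiction
      (roots-of-unity-bound
        (∷-injective (orbit-injective period) λ i 1≈ → ω≉1 (iter-injective (toℕ i) (trans (sym 1≈) (sym (iter-1 (toℕ i))))))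
        λ { zero → Mul.·-ε p ; (suc i) → trans (sym (iter-^ (toℕ i) ω p)) (trans (iter-cong (toℕ i) ωᵖ≈1) (iter-1 (toℕ i))) })
      ℕ.1+n≰n

  -- If σ ω = −ω then σ² fixes y = x₀ ^ (n / 4), because ω² = −1.
  fourth-root-fixed : ∀ {m} → n ≡ 4 ℕ.* m → Fixed (ζ ^ m)
  -- Since ω² = -1 is fixed by σ, σω and ω have equal squares and can differ only in sign.
  fourth-root-fixed {m} n≡4m = by-sign (equal-squares (begin
      iter 1 ω * iter 1 ω   ≈⟨ iter-* 1 ω ω ⟨
      iter 1 (ω * ω)        ≈⟨ ∙-cancelʳ 1# (iter 1 (ω * ω)) (ω * ω) (trans (trans (+-congˡ (sym (iter-1 1)))
                               (trans (sym (iter-+ 1 (ω * ω) 1#)) (trans (iter-cong 1 ω²+1≈0) (iter-0 1)))) (sym ω²+1≈0)) ⟩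
      ω * ω                 ∎))
    where
    open import Algebra.Properties.Group +-group using (∙-cancelʳ)
    ω = ζ ^ m
    y = x₀ ^ m
    ω²≈ : ω * ω ≈ ζ ^ (2 ℕ.* m)
    ω²≈ = trans (*-congˡ (sym (*-identityʳ ω))) (trans (^-assocʳ ζ m 2) (reflexive (≡.cong (ζ ^_) (ℕ.*-comm m 2))))
    ω²≉1 : ω * ω ≉ 1#
    ω²≉1 eq = n∤multiple {4} {2} {m} n≡4m (s≤s (s≤s (s≤s z≤n))) (proj₂ ζ-order (2 ℕ.* m) (trans (sym ω²≈) eq))
    ω⁴≈1 : (ω * ω) * (ω * ω) ≈ 1# * 1#
    ω⁴≈1 = begin
      (ω * ω) * (ω * ω)                  ≈⟨ *-cong ω²≈ ω²≈ ⟩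
      ζ ^ (2 ℕ.* m) * ζ ^ (2 ℕ.* m)      ≈⟨ ^-homo-* ζ (2 ℕ.* m) (2 ℕ.* m) ⟨
      ζ ^ (2 ℕ.* m ℕ.+ 2 ℕ.* m)          ≡⟨ ≡.cong (ζ ^_) (≡.trans (≡.sym (ℕ.*-distribʳ-+ m 2 2)) (≡.sym n≡4m)) ⟩
      ζ ^ n                              ≈⟨ trans ζⁿ≈1 (sym (*-identityʳ 1#)) ⟩
      1# * 1#                            ∎
    ω²+1≈0 : ω * ω + 1# ≈ 0#
    ω²+1≈0 with equal-squares ω⁴≈1
    ... | inj₁ ω²≈1 = contradiction ω²≈1 ω²≉1
    ... | inj₂ eq   = eq
    by-sign : iter 1 ω ≈ ω ⊎ iter 1 ω + ω ≈ 0# → Fixed ω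
    by-sign (inj₁ fixed) = fixed
    by-sign (inj₂ neg)   = contradiction (x₀^-fixed⇒∣ m 2 (begin
        iter 1 (iter 1 y)      ≈⟨ iter-cong 1 (σ-x₀^ m) ⟩
        iter 1 (ω * y)         ≈⟨ iter-* 1 ω y ⟩
        iter 1 ω * iter 1 y    ≈⟨ trans (*-congˡ (σ-x₀^ m)) (sym (*-assoc _ ω y)) ⟩
        iter 1 ω * ω * y       ≈⟨ *-congʳ (∙-cancelʳ (ω * ω) (iter 1 ω * ω) 1# (trans
                                  (trans (sym (distribʳ ω (iter 1 ω) ω)) (trans (*-congʳ neg) (zeroˡ ω)))
                                  (trans (sym ω²+1≈0) (+-comm _ _)))) ⟩
        1# * y                 ≈⟨ *-identityˡ y ⟩
        y                      ∎))
      (n∤multiple {4} {2} {m} n≡4m (s≤s (s≤s (s≤s z≤n))))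

  er∣s : er n ∣ s
  er∣s = er-least
    (λ { {p} pp (divides m n≡mp) → let n≡pm = ≡.trans n≡mp (ℕ.*-comm m p) in fixed⇒∣s p m n≡pm (prime-root-fixed {p} {m} pp n≡pm) })
    (λ { (divides m n≡m4) → let n≡4m = ≡.trans n≡m4 (ℕ.*-comm m 4) in fixed⇒∣s 4 m n≡4m (fourth-root-fixed {m} n≡4m) })

  |μₙ|≡n : HasCardinality (μ n L) n
  |μₙ|≡n = μ-cardinality

  -- As `er n` divides `s`, the power of ζ with exponent n / er n is fixed by σ. Its preimage in `K`
  -- has order `er n`.
  |μₑᵣ|≡er : HasCardinality (μ (er n) K) (er n)
  |μₑᵣ|≡er with er∣ n
  ... | divides m n≡m*er = from-base (fixed⇒base (∣s⇒fixed (er n) m n≡er*m er∣s))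
    where
    n≡er*m = ≡.trans n≡m*er (ℕ.*-comm m (er n))
    instance
      er≢0 : NonZero (er n)
      er≢0 = cofactor-nonZero {q = m} n≡m*er
    from-base : ζ ^ m ∈ Base → HasCardinality (μ (er n) K) (er n)
    from-base (k , ζᵐ≈ιk) = K.PrimitiveRoot.μ-cardinality {ζ = k}
      ( ι-injective (trans (ι-k^ (er n)) (trans (Mul.multiple-·≈ε ζⁿ≈1 (∣-reflexive n≡m*er)) (sym ι-1)))
      , λ j kʲ≈1 → *-cancelˡ-∣ m {{cofactor-nonZero {q = er n} n≡er*m}} (≡.subst (_∣ m ℕ.* j) n≡m*er
          (proj₂ ζ-order (m ℕ.* j) (trans (sym (ι-k^ j)) (trans (ι-cong kʲ≈1) ι-1)))) )
      where
      ι-k^ : ∀ j → ι (k K.^ j) ≈ ζ ^ (m ℕ.* j)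
      ι-k^ j = trans (ι-^ k j) (trans (^-congˡ j (sym ζᵐ≈ιk)) (^-assocʳ ζ m j))

  n·1≉0ᴷ : n K.· K.1# K.≉ K.0#
  n·1≉0ᴷ eq = n·1≉0 (trans (sym (ι-· n)) (trans (ι-cong eq) ι-0))

  -- Let a prime `p` divide both ℓ = q p and `n`. Then p · 1 is nonzero because n · 1 is, so q · 1 =
  -- 0 and ℓ divides q, which leaves p = 1.
  characteristic-coprime : ∀ ℓ → 0 < ℓ → K.HasCharacteristic ℓ → Coprime ℓ n
  characteristic-coprime ℓ 0<ℓ char = coprime-by-primes λ { {p} pp (divides q ℓ≡qp) p∣n →
      let p·1≉0 = λ p·1≈0 → n·1≉0ᴷ (multiple-·1 p·1≈0 p∣n)
          q·1≈0 = K.*≈0⇒ (K.trans (K.sym (×1-homo-* p q)) (Equivalence.from (char (p ℕ.* q)) (∣-reflexive (≡.trans ℓ≡qp (ℕ.*-comm q p))))) p·1≉0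
      in ∣1⇒≡1 (*-cancelˡ-∣ q {{q≢0 ℓ≡qp}} (≡.subst₂ _∣_ ℓ≡qp (≡.sym (ℕ.*-identityʳ q)) (Equivalence.to (char q) q·1≈0))) }
    where
    open import Algebra.Properties.Semiring.Mult K.semiring using (×1-homo-*)
    instance
      ℓ≢0 : NonZero ℓ
      ℓ≢0 = ℕ.>-nonZero 0<ℓ
    q≢0 : ∀ {q p} → ℓ ≡ q ℕ.* p → NonZero q
    q≢0 ℓ≡qp = ℕ.≢-nonZero λ { ≡.refl → ℕ.≢-nonZero⁻¹ ℓ ℓ≡qp }
    multiple-·1 : ∀ {p j} → p K.· K.1# K.≈ K.0# → p ∣ j → j K.· K.1# K.≈ K.0#
    multiple-·1 {p} p·1≈0 (divides q ≡.refl) = K.trans (×1-homo-* q p) (K.trans (K.*-congˡ p·1≈0) (K.zeroʳ _))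

  primary-trivial : ∀ ℓ → 0 < ℓ → K.HasCharacteristic ℓ → ∀ d → d ∈ PrimaryComponent D ℓ → d ≈ᴰ εᴰ
  primary-trivial ℓ 0<ℓ char d (k , ℓᵏd≈ε) = descend k ℓᵏd≈ε
    where
    descend : ∀ k → (ℓ ℕ.^ k) ·ᴰ d ≈ᴰ εᴰ → d ≈ᴰ εᴰ
    descend zero    eq = D.trans (D.sym (1·ᴰ d)) eq
    descend (suc k) eq = descend k (Deg.coprime-·≈ε (characteristic-coprime ℓ 0<ℓ char)
      (D.trans (·ᴰ-assoc d ℓ (ℓ ℕ.^ k)) eq) (n·≈ε ((ℓ ℕ.^ k) ·ᴰ d)))

  -- Each component is one-dimensional: a unit `v` of degree -d carries `x` and `y` into degree 0,
  -- which is K.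
  homogeneous-multiple : ∀ {d x y} → x ∈ component d → x ≉ 0# → y ∈ component d → ∃[ c ] Fixed c × y ≈ c * x
  homogeneous-multiple {d} {x} {y} x∈d x≉0 y∈d with has-unit (d ⁻¹ᴰ)
  ... | v , v∈ , v-unit with invert (*-≉0 x≉0 (unit⇒≉0 v-unit))
  ... | w , xvw≈1 = y * v * w , fixed-* (fixed-product y∈d) (fixed-inverse xvw≈1 (fixed-product x∈d)) , (begin
      y                   ≈⟨ trans (sym (*-identityʳ y)) (*-congˡ (sym xvw≈1)) ⟩
      y * (x * v * w)     ≈⟨ solve 4 (λ y x v w → y :* (x :* v :* w) := y :* v :* w :* x) refl y x v w ⟩
      y * v * w * x       ∎)
    where
    fixed-product : ∀ {z} → z ∈ component d → Fixed (z * v)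
    fixed-product z∈d = ∈0⇒fixed (component-resp (D.inverseʳ d) refl (*-graded z∈d v∈))

  -- Intermediate fields as sums of components

  module _ (E : IntermediateField) where
    open IntermediateField E renaming (member to E∋; resp to E-resp; +-closed to E-+; *-closed to E-*)

    fixed∈E : ∀ {x} → Fixed x → x ∈ E∋
    fixed∈E fx with fixed⇒base fx
    ... | k , x≈ιk = E-resp (sym x≈ιk) (contains-K k)

    degrees : Subgroup D
    degrees = record
      { member    = λ d → ∃[ x ] x ∈ component d × x ≉ 0# × x ∈ E∋
      ; resp      = λ d≈e (x , x∈d , x≉0 , x∈E) → x , component-resp d≈e refl x∈d , x≉0 , x∈E
      ; ε-closed  = 1# , fixed⇒∈0 (iter-1 1) , 1≉0 , fixed∈E (iter-1 1)
      ; ∙-closed  = λ (x , x∈d , x≉0 , x∈E) (y , y∈e , y≉0 , y∈E) → x * y , *-graded x∈d y∈e , *-≉0 x≉0 y≉0 , E-* x∈E y∈E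
      ; ⁻¹-closed = inverse-closed
      }
      where
      inverse-closed : ∀ {d} → (∃[ x ] x ∈ component d × x ≉ 0# × x ∈ E∋) →
        ∃[ x ] x ∈ component (d ⁻¹ᴰ) × x ≉ 0# × x ∈ E∋
      inverse-closed {d} (x , x∈d , x≉0 , x∈E) with has-unit (d ⁻¹ᴰ) | invert x≉0
      -- The product x v has degree 0, so it lies in K and in `E`; hence v = x⁻¹ (x v) lies in `E`.
      ... | v , v∈ , v-unit | w , xw≈1 = v , v∈ , unit⇒≉0 v-unit , E-resp (begin
          w * (x * v)   ≈⟨ *-assoc w x v ⟨
          w * x * v     ≈⟨ trans (*-congʳ (trans (*-comm w x) xw≈1)) (*-identityˡ v) ⟩
          v             ∎)
        (E-* (inv-closed x∈E xw≈1) (fixed∈E (∈0⇒fixed (component-resp (D.inverseʳ d) refl (*-graded x∈d v∈)))))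

    -- E is the fixed field of σ ^ m, which x₀ ^ (n / m) generates.
    E⊆ : ∀ {y} → y ∈ E∋ → y ∈ L⟨ degrees ⟩
    E⊆ {y} y∈E with period-exists E∋ (ℕ.>-nonZero⁻¹ n) (λ x _ → iterN x)
    ... | m , period with Period.period-∣ period (λ x _ → iterN x)
    ... | divides q n≡qm = graded (artin-spanning {{Period.nonZero period}}
        (powers-independent {m = m} w∈ w≉0 λ {j} 0<j j<m jqd≈ε → n∤multiple {m} {j} {q} {{ℕ.>-nonZero 0<j}} n≡mq j<m
          (proj₂ d₀-order (j ℕ.* q) (D.trans (D.sym (·ᴰ-assoc d₀ j q)) jqd≈ε)))
        (λ i → trans (iter-^ m w (toℕ i)) (^-congˡ (toℕ i) w-fixed))
        (Period.fixes period y y∈E))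
      where
      n≡mq = ≡.trans n≡qm (ℕ.*-comm q m)
      w = x₀ ^ q
      w∈ : w ∈ component (q ·ᴰ d₀)
      w∈ = power-∈ q x₀∈
      w≉0 : w ≉ 0#
      w≉0 = ^-≉0 q x₀≉0
      w-fixed : iter m w ≈ w
      w-fixed = x₀^-fixed q m (∣-reflexive n≡mq)
      w^∈E : ∀ i → w ^ i ∈ E∋
      w^∈E zero    = fixed∈E (iter-1 1)
      w^∈E (suc i) = E-* (fixed-by-period⇒∈ E∋ E-resp fixed∈E E-+ E-* period w-fixed) (w^∈E i)
      graded : y ∈ Combination {m} (λ i → w ^ toℕ i) → y ∈ L⟨ degrees ⟩
      graded (c , c-fixed , y≈Σ) = m , (λ i → toℕ i ·ᴰ (q ·ᴰ d₀)) , (λ i → c i * w ^ toℕ i)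
        , (λ i → w ^ toℕ i , power-∈ (toℕ i) w∈ , ^-≉0 (toℕ i) w≉0 , w^∈E (toℕ i))
        , (λ i → scale (c-fixed i) (power-∈ (toℕ i) w∈)) , y≈Σ

    ⊆E : ∀ {y} → y ∈ L⟨ degrees ⟩ → y ∈ E∋
    ⊆E (k , d , y , d∈ , y∈ , x≈Σ) = E-resp (sym x≈Σ) (sum∈ E∋ E-resp fixed∈E E-+ E-* {k} {y} λ i → multiple∈E {d i} {y i} (d∈ i) (y∈ i))
      where
      multiple∈E : ∀ {d y} → (∃[ x ] x ∈ component d × x ≉ 0# × x ∈ E∋) → y ∈ component d → y ∈ E∋
      multiple∈E (x , x∈d , x≉0 , x∈E) y∈d =
        let c , c-fixed , y≈cx = homogeneous-multiple x∈d x≉0 y∈d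
        in E-resp (sym y≈cx) (E-* (fixed∈E c-fixed) x∈E)

  isCoGalois : IsCoGalois L|K 𝓛
  isCoGalois = record
    { primary-trivial = primary-trivial
    ; intermediate    = λ E → degrees E , E⊆ E , ⊆E E
    }

-- From roots of unity to a grading by ℤ/n

module RadicalCyclicExtensions (em : ∀ {a : Level} → ExcludedMiddle a) {u : Level} {K L : Field u}
  (L|K : Extension K L) {n : ℕ} (cyclic : IsFiniteCyclic L|K n)
  (|μₙ|≡n : HasCardinality (μ n L) n) (|μₑᵣ|≡er : HasCardinality (μ (er n) K) (er n)) where
  open CyclicExtensions em L|K cyclic
  open Extension L|K using (ι)
  open IsRingHomomorphism (Extension.isRingHomomorphism L|K)
    renaming (⟦⟧-cong to ι-cong; 1#-homo to ι-1)
  open Arithmetic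
  open import Relation.Binary.Reasoning.Setoid setoid

  abstract
    primitive-root : ∃[ ζ ] HasOrder ζ n
    primitive-root = exists-primitive-root |μₙ|≡n

  ζ : Carrier
  ζ = proj₁ primitive-root

  open RootAction (proj₂ primitive-root)

  -- `K` already contains `er n` roots of this exponent, so an ω outside `K` would be one too many.
  base-root-fixed : ∀ {ω} → .{{NonZero (er n)}} → ω ^ er n ≈ 1# → Fixed ω
  base-root-fixed {ω} ω^er≈1 = decidable-stable em λ ¬fixed → ℕ.1+n≰n (roots-of-unity-bound {n = er n}
    (∷-injective {ρ = ι ∘ K.roots |μₑᵣ|≡er} (λ eq → K.roots-injective |μₑᵣ|≡er (ι-injective eq))
      λ i ω≈ιk → ¬fixed (base⇒fixed (_ , ω≈ιk)))
    λ { zero → ω^er≈1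
      ; (suc i) → trans (sym (ι-^ _ (er n))) (trans (ι-cong (proj₂ (proj₂ (Inverse.from |μₑᵣ|≡er i)))) ι-1) })

  er∣s : er n ∣ s
  er∣s with er∣ n
  ... | divides m n≡m*er = fixed⇒∣s (er n) m (≡.trans n≡m*er (ℕ.*-comm m (er n)))
    (base-root-fixed {{cofactor-nonZero {q = m} n≡m*er}} (trans (^-assocʳ ζ m (er n)) (Mul.multiple-·≈ε ζⁿ≈1 (∣-reflexive n≡m*er))))

  -- ζ · σζ ⋯ σ^(j−1) ζ
  partial-norm : ℕ → Carrier
  partial-norm j = ζ ^ geometric s j

  partial-norm-suc : ∀ j → partial-norm (suc j) ≈ ζ * iter 1 (partial-norm j)
  partial-norm-suc j = *-congˡ (begin
    ζ ^ (g ℕ.+ s ℕ.* g)      ≈⟨ ^-homo-* ζ g (s ℕ.* g) ⟩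
    ζ ^ g * ζ ^ (s ℕ.* g)    ≡⟨ ≡.cong (λ j → ζ ^ g * ζ ^ j) (ℕ.*-comm s g) ⟩
    ζ ^ g * ζ ^ (g ℕ.* s)    ≈⟨ σ-power g ⟨
    iter 1 (ζ ^ g)           ∎)
    where g = geometric s j

  norm≈1 : partial-norm n ≈ 1#
  norm≈1 = Mul.multiple-·≈ε ζⁿ≈1 (n∣geometric-n n s λ pp p∣n → ∣-trans (prime∣er pp p∣n) er∣s)

  partial-norm≈1⇒n∣ : ∀ {j} → partial-norm j ≈ 1# → n ∣ j
  partial-norm≈1⇒n∣ {j} eq = n∣geometric⇒n∣ n s (λ pp p∣n → ∣-trans (prime∣er pp p∣n) er∣s)
    (λ 4∣n → ∣-trans (4∣er 4∣n) er∣s) j (proj₂ (proj₂ primitive-root) (geometric s j) eq)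

  -- Hilbert 90 for ζ, which has norm 1
  abstract
    hilbert90 : ∃[ β ] β ≉ 0# × ζ * iter 1 β ≈ β
    hilbert90 = resolvent (decidable-stable em λ none → 1≉0 (trans
      (sym (reflexive (≡.cong partial-norm (Fin.toℕ-fromℕ< (ℕ.>-nonZero⁻¹ n)))))
      (iterates-independent U _ _ (Period.minimal σ-order) (λ j → partial-norm (toℕ j))
        (λ {θ} _ → ≈-stable λ β≉0 → none (θ , β≉0)) (fromℕ< (ℕ.>-nonZero⁻¹ n)))))
      where
      β : Carrier → Carrier
      -- The Lagrange resolvent. It is nonzero for some θ by Dedekind, because its coefficient at j
      -- = 0 is `partial-norm 0`, which is 1.
      β θ = sum {n} (λ j → partial-norm (toℕ j) * iter (toℕ j) θ)
      resolvent : ∃[ θ ] β θ ≉ 0# → ∃[ β ] β ≉ 0# × ζ * iter 1 β ≈ β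
      resolvent (θ , β≉0) = β θ , β≉0 , (begin
        ζ * iter 1 (β θ)
          ≈⟨ trans (*-congˡ (iter-sum 1 {n} (λ j → partial-norm (toℕ j) * iter (toℕ j) θ)))
               (*-distribˡ-sum {n} ζ (λ j → iter 1 (partial-norm (toℕ j) * iter (toℕ j) θ))) ⟩
        sum {n} (λ j → ζ * iter 1 (partial-norm (toℕ j) * iter (toℕ j) θ))
          ≈⟨ sum-cong-≋ {n} (λ j → trans (*-congˡ (iter-* 1 _ _)) (trans (sym (*-assoc _ _ _)) (*-congʳ (sym (partial-norm-suc (toℕ j)))))) ⟩
        sum {n} (λ j → partial-norm (suc (toℕ j)) * iter (suc (toℕ j)) θ)
          -- The new last term equals the old first one, since both the norm of ζ and σ^n are
          -- trivial.
          ≈⟨ cyclic-shift n (λ j → partial-norm j * iter j θ) (*-cong norm≈1 (iterN θ)) ⟩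
        β θ ∎)

  β : Carrier
  β = proj₁ hilbert90

  β≉0 : β ≉ 0#
  β≉0 = proj₁ (proj₂ hilbert90)

  -- It follows that σ^j fixes β only if `partial-norm j` is 1, so β has `n` conjugates.
  partial-norm-action : ∀ j → partial-norm j * iter j β ≈ β
  partial-norm-action zero    = *-identityˡ β
  partial-norm-action (suc j) = begin
    partial-norm (suc j) * iter (suc j) β        ≈⟨ trans (*-congʳ (partial-norm-suc j)) (*-assoc _ _ _) ⟩
    ζ * (iter 1 (partial-norm j) * iter (suc j) β) ≈⟨ *-congˡ (sym (iter-* 1 _ _)) ⟩
    ζ * iter 1 (partial-norm j * iter j β)       ≈⟨ *-congˡ (iter-cong 1 (partial-norm-action j)) ⟩
    ζ * iter 1 β                                 ≈⟨ proj₂ (proj₂ hilbert90) ⟩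
    β                                            ∎

  βⁿ-fixed : Fixed (β ^ n)
  βⁿ-fixed = begin
    iter 1 (β ^ n)             ≈⟨ iter-^ 1 β n ⟩
    iter 1 β ^ n               ≈⟨ trans (*-congʳ ζⁿ≈1) (*-identityˡ _) ⟨
    ζ ^ n * iter 1 β ^ n       ≈⟨ ^-distrib-* ζ (iter 1 β) n ⟨
    (ζ * iter 1 β) ^ n         ≈⟨ ^-congˡ n (proj₂ (proj₂ hilbert90)) ⟩
    β ^ n                      ∎

  β-period : Period (_≡ β) n
  β-period = record
    { fixes   = fixes-point n (iterN β)
    ; minimal = λ {j} 0<j j<n fixes → ℕ.<⇒≱ j<n (∣⇒≤ {{ℕ.>-nonZero 0<j}} (partial-norm≈1⇒n∣
        (*-cancelʳ β≉0 (trans (*-congˡ (sym (fixes β ≡.refl))) (trans (partial-norm-action j) (sym (*-identityˡ β)))))))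
    }

  -- Applying σ^j to a relation with fixed coefficients shows that one polynomial with `n`
  -- coefficients vanishes at all `n` conjugates of β.
  β-powers-independent : Independent {n} (λ i → β ^ toℕ i)
  β-powers-independent c c-fixed Σ≈0 = vanishing-polynomial c (orbit-injective β-period) λ j → begin
    eval c (iter (toℕ j) β)
      ≈⟨ sum-cong-≋ {n} (λ i → trans (*-cong (sym (iter-fixed (toℕ j) (c-fixed i))) (sym (iter-^ (toℕ j) β (toℕ i))))
           (sym (iter-* (toℕ j) (c i) (β ^ toℕ i)))) ⟩
    sum (λ i → iter (toℕ j) (c i * β ^ toℕ i))
      ≈⟨ iter-sum (toℕ j) (λ i → c i * β ^ toℕ i) ⟨
    iter (toℕ j) (sum (λ i → c i * β ^ toℕ i))
      ≈⟨ trans (iter-cong (toℕ j) Σ≈0) (iter-0 (toℕ j)) ⟩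
    0# ∎

  β-powers-span : ∀ x → x ∈ Combination {n} (λ i → β ^ toℕ i)
  β-powers-span x = artin-spanning β-powers-independent (λ i → iterN _) (iterN x)

  -- Natural numbers modulo congruence let a degree serve directly as an exponent of β; the inverse
  -- (n - 1) i stays within ℕ.
  ℤ/n : AbelianGroup u u
  ℤ/n = record
    { Carrier = Lift u ℕ
    ; _≈_     = λ (lift i) (lift j) → Lift u (i % n ≡ j % n)
    ; _∙_     = λ (lift i) (lift j) → lift (i ℕ.+ j)
    ; ε       = lift 0
    ; _⁻¹     = λ (lift i) → lift (ℕ.pred n ℕ.* i)
    ; isAbelianGroup = record
      { isGroup = record
        { isMonoid = record
          { isSemigroup = record
            { isMagma = record
              { isEquivalence = record
                { refl  = lift ≡.refl
                ; sym   = λ (lift p) → lift (≡.sym p)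
                ; trans = λ (lift p) (lift q) → lift (≡.trans p q)
                }
              ; ∙-cong = λ {(lift i)} {(lift i′)} {(lift j)} {(lift j′)} (lift p) (lift q) → lift (≡.trans (%-distribˡ-+ i j n)
                  (≡.trans (≡.cong₂ (λ a b → (a ℕ.+ b) % n) p q) (≡.sym (%-distribˡ-+ i′ j′ n))))
              }
            ; assoc = λ (lift i) (lift j) (lift k) → lift (≡.cong (_% n) (ℕ.+-assoc i j k))
            }
          ; identity = (λ _ → lift ≡.refl) , λ (lift i) → lift (≡.cong (_% n) (ℕ.+-identityʳ i))
          }
        ; inverse = (λ (lift i) → lift (≡.trans (≡.cong (_% n) (ℕ.+-comm (ℕ.pred n ℕ.* i) i)) (inverseʳ i))) , λ (lift i) → lift (inverseʳ i)
        ; ⁻¹-cong = λ {(lift i)} {(lift j)} (lift p) → lift (≡.trans (%-distribˡ-* (ℕ.pred n) i n)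
            (≡.trans (≡.cong (λ a → (ℕ.pred n % n ℕ.* a) % n) p) (≡.sym (%-distribˡ-* (ℕ.pred n) j n))))
        }
      ; comm = λ (lift i) (lift j) → lift (≡.cong (_% n) (ℕ.+-comm i j))
      }
    }
    where
    inverseʳ : ∀ i → (i ℕ.+ ℕ.pred n ℕ.* i) % n ≡ 0 % n
    inverseʳ i = ≡.trans (≡.cong (λ k → (k ℕ.* i) % n) (ℕ.suc-pred n)) (≡.trans (≡.cong (_% n) (ℕ.*-comm n i)) (≡.trans (m*n%n≡0 i n) (≡.sym (m*n%n≡0 0 n))))

  Component : Lift u ℕ → Pred Carrier u
  Component (lift i) x = ∃[ c ] Fixed c × x ≈ c * β ^ i

  -- Since β^n is a nonzero fixed element, the exponent matters only modulo `n`, up to a scalar.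
  reduce : ∀ i → ∃[ b ] Fixed b × b ≉ 0# × β ^ i ≈ b * β ^ (i % n)
  reduce i = (β ^ n) ^ (i / n) , trans (iter-^ 1 (β ^ n) (i / n)) (^-congˡ (i / n) βⁿ-fixed) , ^-≉0 (i / n) (^-≉0 n β≉0) , (begin
    β ^ i                                 ≡⟨ ≡.cong (β ^_) (m≡m%n+[m/n]*n i n) ⟩
    β ^ (i % n ℕ.+ (i / n) ℕ.* n)         ≈⟨ ^-homo-* β (i % n) ((i / n) ℕ.* n) ⟩
    β ^ (i % n) * β ^ ((i / n) ℕ.* n)     ≈⟨ trans (*-comm _ _) (*-congʳ (trans (reflexive (≡.cong (β ^_) (ℕ.*-comm (i / n) n))) (sym (^-assocʳ β n (i / n))))) ⟩
    (β ^ n) ^ (i / n) * β ^ (i % n)       ∎)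

  Component-% : ∀ {i j x} → i % n ≡ j % n → x ∈ Component (lift i) → x ∈ Component (lift j)
  Component-% {i} {j} {x} i≡j (c , c-fixed , x≈cβⁱ) =
    let bᵢ , bᵢ-fixed , _ , βⁱ≈ = reduce i
        bⱼ , bⱼ-fixed , bⱼ≉0 , βʲ≈ = reduce j
        d , bⱼd≈1 = invert bⱼ≉0
    in c * bᵢ * d , fixed-* (fixed-* c-fixed bᵢ-fixed) (fixed-inverse bⱼd≈1 bⱼ-fixed) , (begin
      x                              ≈⟨ trans x≈cβⁱ (*-congˡ βⁱ≈) ⟩
      c * (bᵢ * β ^ (i % n))         ≡⟨ ≡.cong (λ r → c * (bᵢ * β ^ r)) i≡j ⟩
      c * (bᵢ * β ^ (j % n))         ≈⟨ *-congˡ (*-congˡ (trans (*-congʳ bⱼd≈1) (*-identityˡ _))) ⟨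
      c * (bᵢ * (bⱼ * d * β ^ (j % n))) ≈⟨ solve 5 (λ c bᵢ bⱼ d y → c :* (bᵢ :* (bⱼ :* d :* y)) := c :* bᵢ :* d :* (bⱼ :* y)) refl c bᵢ bⱼ d (β ^ (j % n)) ⟩
      c * bᵢ * d * (bⱼ * β ^ (j % n)) ≈⟨ *-congˡ βʲ≈ ⟨
      c * bᵢ * d * β ^ j             ∎)

  -- Distinct degrees have distinct residues below `n`, so after reduction the summands are scalar
  -- multiples of distinct members of an independent family.
  components-independent : ∀ {m} (d : Vector (Lift u ℕ) m) (y : Vector Carrier m) →
    Injective _≡_ (AbelianGroup._≈_ ℤ/n) d → (∀ i → y i ∈ Component (d i)) → sum y ≈ 0# → ∀ i → y i ≈ 0#
  components-independent {m} d y d-inj y∈ Σ≈0 i =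
    trans (y≈cβ i) (trans (*-congʳ (independent-∘ β-powers-independent residue-injective c (proj₁ ∘ proj₂ ∘ canonical)
      (trans (sum-cong-≋ {m} (λ i → sym (y≈cβ i))) Σ≈0) i)) (zeroˡ _))
    where
    degree : Fin m → ℕ
    degree i = lower (d i)
    residue : Fin m → Fin n
    residue i = fromℕ< (m%n<n (degree i) n)
    residue-injective : Injective _≡_ _≡_ residue
    residue-injective {i} {j} eq = d-inj (lift (Fin.fromℕ<-injective _ _ (m%n<n (degree i) n) (m%n<n (degree j) n) eq))
    canonical : ∀ i → ∃[ c ] Fixed c × y i ≈ c * β ^ (degree i % n)
    canonical i =
      let c , c-fixed , y≈ = y∈ i
          b , b-fixed , _ , β≈ = reduce (degree i)
      in c * b , fixed-* c-fixed b-fixed , trans y≈ (trans (*-congˡ β≈) (sym (*-assoc _ _ _)))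
    c : Vector Carrier m
    c = proj₁ ∘ canonical
    y≈cβ : ∀ i → y i ≈ c i * β ^ toℕ (residue i)
    y≈cβ i = trans (proj₂ (proj₂ (canonical i))) (*-congˡ (reflexive (≡.cong (β ^_) (≡.sym (Fin.toℕ-fromℕ< (m%n<n (degree i) n))))))

  unitaryGrading : UnitaryGrading L|K ℤ/n
  unitaryGrading = record
    { grading = record
      { component   = Component
      ; resp        = λ { {lift i} {lift j} (lift i≡j) x≈y (c , c-fixed , x≈) → Component-% {i} {j} i≡j (c , c-fixed , trans (sym x≈y) x≈) }
      ; 0-closed    = 0# , iter-0 1 , sym (zeroˡ _)
      ; +-closed    = λ (c , c-fixed , x≈) (e , e-fixed , y≈) →
          c + e , trans (iter-+ 1 c e) (+-cong c-fixed e-fixed) , trans (+-cong x≈ y≈) (sym (distribʳ _ c e))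
      ; ·-closed    = λ k (c , c-fixed , x≈) → ι k * c , fixed-* (ι-fixed k) c-fixed , trans (*-congˡ x≈) (sym (*-assoc _ _ _))
      ; *-graded    = λ { {lift i} {lift j} (c , c-fixed , x≈) (e , e-fixed , y≈) → c * e , fixed-* c-fixed e-fixed ,
          trans (*-cong x≈ y≈) (trans (interchange c (β ^ i) e (β ^ j)) (*-congˡ (sym (^-homo-* β i j)))) }
      ; spanning    = λ x → let c , c-fixed , x≈Σ = β-powers-span x in
          n , (λ i → lift (toℕ i)) , (λ i → c i * β ^ toℕ i) , (λ _ → tt) , (λ i → c i , c-fixed i , refl) , x≈Σ
      ; independent = components-independent
      }
    ; component-0 = (λ (c , c-fixed , x≈c1) → fixed⇒base (trans (iter-cong 1 (trans x≈c1 (*-identityʳ c))) (trans c-fixed (sym (trans x≈c1 (*-identityʳ c))))))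
                  , (λ x∈K → _ , base⇒fixed x∈K , sym (*-identityʳ _))
    ; has-unit    = λ (lift i) → β ^ i , (1# , iter-1 1 , sym (*-identityˡ _)) , ≉0⇒unit (^-≉0 i β≉0)
    }

theorem4p4 : (∀ {a : Level} → ExcludedMiddle a) →
    ∀ {u : Level} {K L : Field u} (L|K : Extension K L) (n : ℕ) →
    IsFiniteCyclic L|K n →
    (HasUnitaryGrading L|K ⇔
    (HasCardinality (μ n L) n × HasCardinality (μ (er n) K) (er n)))
    × (∀ (D : AbelianGroup u u) (𝓛 : UnitaryGrading L|K D) → IsCoGalois L|K 𝓛)
theorem4p4 em L|K n cyclic =
  mk⇔ (λ (_ , 𝓛) → GradedCyclicExtensions.|μₙ|≡n em L|K cyclic 𝓛 , GradedCyclicExtensions.|μₑᵣ|≡er em L|K cyclic 𝓛)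
      (λ (|μₙ|≡n , |μₑᵣ|≡er) → RadicalCyclicExtensions.ℤ/n em L|K cyclic |μₙ|≡n |μₑᵣ|≡er
                             , RadicalCyclicExtensions.unitaryGrading em L|K cyclic |μₙ|≡n |μₑᵣ|≡er)
  , λ D 𝓛 → GradedCyclicExtensions.isCoGalois em L|K cyclic 𝓛
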